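{- Let $v$ be a packed word of length $n$. Then $$U_v(t):=(\sigma_1^t)_n*\mathbf{N}_v=\sum_{k=1}^n t^k\,E_n^{[k]}*\mathbf{N}_v=\sum_{w\in \mathrm{WRef}(v)}\binom{t+\max(w)-a_0(v,w)}{\max(w)}\,\mathbf{N}_w,$$ where $a_0(v,w)=\max(u_0(v,w))$.
   Context: $\mathbb{K}$ is a field of characteristic $0$, $t$ an indeterminate, and $\binom{t+c}{m}=\frac{(t+c)(t+c-1)\cdots(t+c-m+1)}{m!}$. A word over the positive integers is packed if its set of letters is $\{1,\dots,r\}$ for some $r$; then $r=\max(u)$. For a word $w$ over a totally ordered alphabet with distinct letters $b_1<\dots<b_r$, $\mathrm{pack}(w)$ is obtained by replacing each $b_i$ by $i$. A packed word $u=u_1\cdots u_n$ is identified with the set composition of $\{1,\dots,n\}$ whose $i$-th block is $\{j:u_j=i\}$. For packed words $v,w$ of length $n$, $w$ is a weak refinement of $v$, written $w\in\mathrm{WRef}(v)$, if $w_i=w_j\Rightarrow v_i=v_j$ for all $i,j$ (each block of $v$ is a union of blocks of $w$). For $w\in\mathrm{WRef}(v)$, $u_0(v,w)$ is the set composition obtained from $w$ by merging two consecutive blocks $p',p''$ whenever the blocks of $v$ containing (the elements of) $p'$ are strictly to the left of those containing (the elements of) $p''$ (i.e. $v_i<v_j$ for all $i\in p'$, $j\in p''$), and iterating until no further blocks can be merged. $\mathbf{WQSym}^*_n$ is the $\mathbb{K}$-vector space with basis $\mathbf{N}_u$, $u$ running over packed words of length $n$, with internal product $\mathbf{N}_u*\mathbf{N}_v=\mathbf{N}_{\mathrm{pack}\binom{u}{v}}$,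 where $\binom{u}{v}$ is the word of biletters $\binom{u_1}{v_1}\cdots\binom{u_n}{v_n}$, ordered lexicographically with priority to the top letter; scalars are extended to $\mathbb{K}[t]$. The degree $n$ component of $\sigma_1^t$ is $$(\sigma_1^t)_n=\sum_{|u|=n}\binom{t}{\max(u)}\mathbf{N}_u=\sum_{k=1}^n t^kE_n^{[k]},$$ the first sum being over all packed words of length $n$; the second equality defines the Eulerian idempotents $E_n^{[k]}$. -}

module Defs where

open import Algebra.Apartness.Bundles using (HeytingField; module HeytingCommutativeRing)
open import Algebra.Bundles using (RawRing; module CommutativeRing)
import Algebra.Definitions.RawMonoid as RawMonoid
import Algebra.Definitions.RawSemiring as RawSemiring
open import Data.Bool.Base using (if_then_else_)
import Data.Fin.Properties as Fin
open import Data.List.Base using (List; []; _∷_; foldr; length; map; upTo; cartesianProductWith; mapMaybe; filter)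
open import Data.List.Relation.Unary.All as All using (All; []; _∷_)
open import Data.List.Relation.Unary.AllPairs using (AllPairs; []; _∷_)
open import Data.List.Relation.Unary.Any using (Any; here; there)
import Data.Maybe.Base as Maybe
open import Data.Nat.Base using (ℕ; zero; suc; _≤_; _<_; z≤n; s≤s; _∸_; _!; NonZero)
  renaming (_⊔_ to _⊔ℕ_)
open import Data.Nat.GeneralisedArithmetic using (fold)
import Data.Nat.Properties as ℕ
open import Data.Product.Base using (_×_; _,_; ∃; proj₁; proj₂)
open import Data.Product.Relation.Binary.Lex.Strict using (×-Lex; ×-isStrictTotalOrder)
open import Data.Product.Relation.Binary.Pointwise.NonDependent using (≡⇒≡×≡; ≡×≡⇒≡)
open import Data.Vec.Base as Vec using (Vec; []; _∷_; lookup)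
open import Data.Vec.Membership.DecPropositional ℕ._≟_ using (_∈?_)
open import Data.Vec.Membership.Propositional using (_∈_)
import Data.Vec.Properties as Vec
import Data.Vec.Relation.Unary.All as VecAll
import Data.Vec.Relation.Unary.All.Properties as VecAll
import Data.Vec.Relation.Unary.Any as VecAny
open import Data.Vec.Membership.Propositional.Properties using (∈-lookup)
open import Function.Base using (_∘_)
open import Function.Bundles using (_⇔_; mk⇔; module Equivalence)
open import Level using (Level)
open import Relation.Binary.Core using (Rel)
open import Relation.Binary.Definitions using (Trichotomous; tri<; tri≈; tri>)
open import Relation.Binary.PropositionalEquality
  using (_≡_; refl; sym; cong; isEquivalence; resp₂)
open import Relation.Binary.Structures using (IsStrictTotalOrder)
open import Relation.Nullary using (Dec; yes; no; does; contradiction)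
open import Relation.Nullary.Decidable using (map′; _×-dec_; _→-dec_; dec⇒maybe)

private variable
  a c ℓ ℓ₁ ℓ₂ : Level
  n : ℕ

------------------------------------------------------------------------
-- Packed words

Word : ℕ → Set
Word n = Vec ℕ n

max : Word n → ℕ
max = Vec.foldr _ _⊔ℕ_ 0

IsPacked : Word n → Set
IsPacked w = ∃ λ r → ∀ i → i ∈ w ⇔ (1 ≤ i × i ≤ r)

∈⇒≤max : ∀ {i} (w : Word n) → i ∈ w → i ≤ max w
∈⇒≤max (x ∷ w) (VecAny.here refl) = ℕ.m≤m⊔n x (max w)
∈⇒≤max (x ∷ w) (VecAny.there i∈w) = ℕ.≤-trans (∈⇒≤max w i∈w) (ℕ.m≤n⊔m x (max w))

max≤ : ∀ {r} (w : Word n) → (∀ {i} → i ∈ w → i ≤ r) → max w ≤ r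
max≤ []      _ = z≤n
max≤ (x ∷ w) h = ℕ.⊔-lub (h (VecAny.here refl)) (max≤ w (h ∘ VecAny.there))

isPacked? : (w : Word n) → Dec (IsPacked w)
isPacked? w = map′ to from
  (VecAll.all? (1 ℕ.≤?_) w ×-dec ℕ.allUpTo? (λ i → suc i ∈? w) (max w))
  where
  Check : Set
  Check = VecAll.All (1 ≤_) w × (∀ {i} → i < max w → suc i ∈ w)

  to : Check → IsPacked w
  to (pos , onto) = max w , λ i → mk⇔
    (λ i∈w → VecAll.lookup pos i∈w , ∈⇒≤max w i∈w)
    (λ { (s≤s z≤n , i<) → onto i< })

  from : IsPacked w → Check
  from (r , letters) =
    VecAll.lookup⁻ (λ j → proj₁ (Equivalence.to (letters _) (∈-lookup j w))) ,
    λ i< → Equivalence.from (letters _) (s≤s z≤n , ℕ.≤-trans i< max≤r)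
    where
    max≤r : max w ≤ r
    max≤r = max≤ w (λ i∈w → proj₂ (Equivalence.to (letters _) i∈w))

-- Packedness is irrelevant, so that packed words are equal as soon as their
-- underlying words are; it can be recomputed with isPacked?.
record PackedWord (n : ℕ) : Set where
  constructor packed
  field
    word      : Word n
    .isPacked : IsPacked word

open PackedWord public

infix 4 _≟ᵖ_
_≟ᵖ_ : (u v : PackedWord n) → Dec (u ≡ v)
packed u p ≟ᵖ packed v q = map′ (λ { refl → refl }) (cong word) (Vec.≡-dec ℕ._≟_ u v)

wordsUpTo : ℕ → (n : ℕ) → List (Word n)
wordsUpTo k zero    = [] ∷ []
wordsUpTo k (suc n) = cartesianProductWith _∷_ (map suc (upTo k)) (wordsUpTo k n)

-- Every packed word of length n, exactly once: its letters are at most n.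
packedWords : (n : ℕ) → List (PackedWord n)
packedWords n =
  mapMaybe (λ w → Maybe.map (λ p → packed w p) (dec⇒maybe (isPacked? w))) (wordsUpTo n n)

------------------------------------------------------------------------
-- Packing

module Packing {A : Set a} {_≺_ : Rel A ℓ} (sto : IsStrictTotalOrder _≡_ _≺_) where

  open IsStrictTotalOrder sto using (compare; _≟_; irrefl) renaming (trans to ≺-trans)

  insert : A → List A → List A
  insert x [] = x ∷ []
  insert x (y ∷ ys) with compare x y
  ... | tri< _ _ _ = x ∷ y ∷ ys
  ... | tri≈ _ _ _ = y ∷ ys
  ... | tri> _ _ _ = y ∷ insert x ys

  -- The distinct letters b₁ ≺ … ≺ bᵣ of a word.
  letters : Vec A n → List A
  letters = Vec.foldr _ insert []

  -- The (1-based) index of a letter in the list of letters.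
  rank : List A → A → ℕ
  rank []       x = 1
  rank (b ∷ bs) x with x ≟ b
  ... | yes _ = 1
  ... | no  _ = suc (rank bs x)

  packWord : Vec A n → Word n
  packWord w = Vec.map (rank (letters w)) w

  Sorted : List A → Set _
  Sorted = AllPairs _≺_

  insert-All : ∀ {p} {P : A → Set p} {x} bs → P x → All P bs → All P (insert x bs)
  insert-All []       px []         = px ∷ []
  insert-All {x = x} (b ∷ bs) px (pb ∷ pbs) with compare x b
  ... | tri< _ _ _ = px ∷ pb ∷ pbs
  ... | tri≈ _ _ _ = pb ∷ pbs
  ... | tri> _ _ _ = pb ∷ insert-All bs px pbs

  insert-sorted : ∀ x bs → Sorted bs → Sorted (insert x bs)
  insert-sorted x []       []         = [] ∷ []
  insert-sorted x (b ∷ bs) (b≺ ∷ s) with compare x b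
  ... | tri< x≺b _ _ = (x≺b ∷ All.map (≺-trans x≺b) b≺) ∷ b≺ ∷ s
  ... | tri≈ _ _ _   = b≺ ∷ s
  ... | tri> _ _ b≺x = insert-All bs b≺x b≺ ∷ insert-sorted x bs s

  letters-sorted : (w : Vec A n) → Sorted (letters w)
  letters-sorted []      = []
  letters-sorted (x ∷ w) = insert-sorted x (letters w) (letters-sorted w)

  insert-here : ∀ x bs → Any (x ≡_) (insert x bs)
  insert-here x []       = here refl
  insert-here x (b ∷ bs) with compare x b
  ... | tri< _ _ _   = here refl
  ... | tri≈ _ x≡b _ = here x≡b
  ... | tri> _ _ _   = there (insert-here x bs)

  insert-there : ∀ {z} x bs → Any (z ≡_) bs → Any (z ≡_) (insert x bs)
  insert-there x (b ∷ bs) z∈ with compare x b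
  ... | tri< _ _ _ = there z∈
  ... | tri≈ _ _ _ = z∈
  insert-there x (b ∷ bs) (here z≡b) | tri> _ _ _ = here z≡b
  insert-there x (b ∷ bs) (there z∈) | tri> _ _ _ = there (insert-there x bs z∈)

  ∈⇒∈letters : ∀ {z} (w : Vec A n) → z ∈ w → Any (z ≡_) (letters w)
  ∈⇒∈letters (x ∷ w) (VecAny.here refl) = insert-here x (letters w)
  ∈⇒∈letters (x ∷ w) (VecAny.there z∈)  = insert-there x (letters w) (∈⇒∈letters w z∈)

  letters-⊆ : (w : Vec A n) → All (_∈ w) (letters w)
  letters-⊆ []      = []
  letters-⊆ (x ∷ w) =
    insert-All (letters w) (VecAny.here refl) (All.map VecAny.there (letters-⊆ w))

  1≤rank : ∀ bs x → 1 ≤ rank bs x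
  1≤rank []       x = s≤s z≤n
  1≤rank (b ∷ bs) x with x ≟ b
  ... | yes _ = s≤s z≤n
  ... | no  _ = s≤s z≤n

  rank≤ : ∀ bs x → Any (x ≡_) bs → rank bs x ≤ length bs
  rank≤ (b ∷ bs) x x∈ with x ≟ b
  rank≤ (b ∷ bs) x x∈          | yes _   = s≤s z≤n
  rank≤ (b ∷ bs) x (here x≡b)  | no x≢b = contradiction x≡b x≢b
  rank≤ (b ∷ bs) x (there x∈)  | no _   = s≤s (rank≤ bs x x∈)

  rank-onto : ∀ bs → Sorted bs → ∀ i → i < length bs → Any (λ x → suc i ≡ rank bs x) bs
  rank-onto (b ∷ bs) _ zero _ = here b-first
    where
    b-first : 1 ≡ rank (b ∷ bs) b
    b-first with b ≟ b
    ... | yes _  = refl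
    ... | no b≢b = contradiction refl b≢b
  rank-onto (b ∷ bs) (b≺ ∷ s) (suc i) (s≤s i<) = there (shift bs b≺ (rank-onto bs s i i<))
    where
    later : ∀ {x} → b ≺ x → suc i ≡ rank bs x → suc (suc i) ≡ rank (b ∷ bs) x
    later {x} b≺x eq with x ≟ b
    ... | yes x≡b = contradiction b≺x (irrefl (sym x≡b))
    ... | no _    = cong suc eq

    shift : ∀ xs → All (b ≺_) xs → Any (λ x → suc i ≡ rank bs x) xs →
            Any (λ x → suc (suc i) ≡ rank (b ∷ bs) x) xs
    shift (x ∷ xs) (b≺x ∷ _)  (here eq) = here (later b≺x eq)
    shift (x ∷ xs) (_ ∷ b≺xs) (there q) = there (shift xs b≺xs q)

  ∈-map-from : ∀ {i} (f : A → ℕ) (w : Vec A n) → i ∈ Vec.map f w → ∃ λ x → x ∈ w × i ≡ f x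
  ∈-map-from f (x ∷ w) (VecAny.here i≡) = x , VecAny.here refl , i≡
  ∈-map-from f (x ∷ w) (VecAny.there i∈) with ∈-map-from f w i∈
  ... | y , y∈ , i≡ = y , VecAny.there y∈ , i≡

  ∈-map-to : ∀ {i} (f : A → ℕ) (w : Vec A n) {x : A} → x ∈ w → i ≡ f x → i ∈ Vec.map f w
  ∈-map-to f (x ∷ w) (VecAny.here refl) i≡ = VecAny.here i≡
  ∈-map-to f (x ∷ w) (VecAny.there x∈)  i≡ = VecAny.there (∈-map-to f w x∈ i≡)

  packWord-isPacked : (w : Vec A n) → IsPacked (packWord w)
  packWord-isPacked w = length bs , λ i → mk⇔ to from
    where
    bs = letters w

    to : ∀ {i} → i ∈ packWord w → 1 ≤ i × i ≤ length bs
    to i∈ with ∈-map-from (rank bs) w i∈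
    ... | x , x∈ , refl = 1≤rank bs x , rank≤ bs x (∈⇒∈letters w x∈)

    find : ∀ {i} xs → All (_∈ w) xs → Any (λ x → i ≡ rank bs x) xs → i ∈ packWord w
    find (x ∷ xs) (x∈ ∷ _)  (here i≡) = ∈-map-to (rank bs) w x∈ i≡
    find (x ∷ xs) (_ ∷ xs∈) (there q) = find xs xs∈ q

    from : ∀ {i} → 1 ≤ i × i ≤ length bs → i ∈ packWord w
    from (s≤s {n = i} z≤n , i<) =
      find bs (letters-⊆ w) (rank-onto bs (letters-sorted w) i i<)

  pack : Vec A n → PackedWord n
  pack w = packed (packWord w) (packWord-isPacked w)

_<ˡᵉˣ_ : Rel (ℕ × ℕ) _
_<ˡᵉˣ_ = ×-Lex _≡_ _<_ _<_

<ˡᵉˣ-isStrictTotalOrder : IsStrictTotalOrder _≡_ _<ˡᵉˣ_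
<ˡᵉˣ-isStrictTotalOrder = record
  { isStrictPartialOrder = record
    { isEquivalence = isEquivalence
    ; irrefl        = λ x≡y → Lex.irrefl (≡⇒≡×≡ x≡y)
    ; trans         = Lex.trans
    ; <-resp-≈      = resp₂ _<ˡᵉˣ_
    }
  ; compare = compare
  }
  where
  module Lex = IsStrictTotalOrder (×-isStrictTotalOrder ℕ.<-isStrictTotalOrder ℕ.<-isStrictTotalOrder)

  compare : Trichotomous _≡_ _<ˡᵉˣ_
  compare x y with Lex.compare x y
  ... | tri< lt ne gt = tri< lt (ne ∘ ≡⇒≡×≡) gt
  ... | tri≈ lt eq gt = tri≈ lt (≡×≡⇒≡ eq) gt
  ... | tri> lt ne gt = tri> lt (ne ∘ ≡⇒≡×≡) gt

packBiword : PackedWord n → PackedWord n → PackedWord n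
packBiword u v = Packing.pack <ˡᵉˣ-isStrictTotalOrder (Vec.zip (word u) (word v))

------------------------------------------------------------------------
-- Weak refinements

infix 4 _∈WRef_ _∈WRef?_

_∈WRef_ : PackedWord n → PackedWord n → Set
w ∈WRef v = ∀ i j → lookup (word w) i ≡ lookup (word w) j → lookup (word v) i ≡ lookup (word v) j

_∈WRef?_ : (w v : PackedWord n) → Dec (w ∈WRef v)
w ∈WRef? v = Fin.all? λ i → Fin.all? λ j →
  (lookup (word w) i ℕ.≟ lookup (word w) j) →-dec (lookup (word v) i ℕ.≟ lookup (word v) j)

WRef : PackedWord n → List (PackedWord n)
WRef {n} v = filter (_∈WRef? v) (packedWords n)

-- The k-th and (k+1)-st blocks of w may be merged.
Mergeable : Word n → Word n → ℕ → Set
Mergeable v w k = ∀ i j → lookup w i ≡ k → lookup w j ≡ suc k → lookup v i < lookup v j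

mergeable? : (v w : Word n) (k : ℕ) → Dec (Mergeable v w k)
mergeable? v w k = Fin.all? λ i → Fin.all? λ j →
  (lookup w i ℕ.≟ k) →-dec ((lookup w j ℕ.≟ suc k) →-dec (lookup v i ℕ.<? lookup v j))

-- Merge the k-th and (k+1)-st blocks.
mergeAt : ℕ → Word n → Word n
mergeAt k = Vec.map λ x → if does (x ℕ.≤? k) then x else x ∸ 1

mergeLeftmost : Word n → Word n → Word n
mergeLeftmost v w with filter (mergeable? v w) (map suc (upTo (max w ∸ 1)))
... | []    = w
... | k ∷ _ = mergeAt k w

-- Every merge lowers the number max w of blocks by one, so after max w rounds
-- no two consecutive blocks can be merged any more.  For w ∈WRef v, a merge
-- does not affect which of the other pairs of neighbours can be merged, so
-- always merging the leftmost pair is no restriction.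
u₀ : PackedWord n → PackedWord n → Word n
u₀ v w = fold (word w) (mergeLeftmost (word v)) (max (word w))

a₀ : PackedWord n → PackedWord n → ℕ
a₀ v w = max (u₀ v w)

------------------------------------------------------------------------
-- WQSym*ₙ with scalars R, as functions from its finite basis to R

module WQSym* (R : RawRing c ℓ) where

  open RawRing R

  WQSym : ℕ → Set c
  WQSym n = PackedWord n → Carrier

  infix  4 _≋_
  infixl 6 _⊕_
  infixr 7 _·_
  infixl 7 _∗_

  _≋_ : WQSym n → WQSym n → Set ℓ
  f ≋ g = ∀ u → f u ≈ g u

  𝟎 : WQSym n
  𝟎 _ = 0#

  _⊕_ : WQSym n → WQSym n → WQSym n
  (f ⊕ g) u = f u + g u

  _·_ : Carrier → WQSym n → WQSym n
  (x · f) u = x * f u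

  N : PackedWord n → WQSym n
  N u v with u ≟ᵖ v
  ... | yes _ = 1#
  ... | no  _ = 0#

  ∑ : ∀ {i} {I : Set i} → List I → (I → WQSym n) → WQSym n
  ∑ xs f = foldr (λ x s → f x ⊕ s) 𝟎 xs

  infixr 5 ∑
  syntax ∑ xs (λ x → f) = ∑[ x ← xs ] f

  -- The bilinear extension of N u ∗ N v = N (packBiword u v).
  _∗_ : WQSym n → WQSym n → WQSym n
  _∗_ {n} f g = ∑[ u ← packedWords n ] ∑[ v ← packedWords n ] (f u * g v) · N (packBiword u v)

------------------------------------------------------------------------
-- Fields of characteristic zero and their polynomials

scalars : HeytingField c ℓ₁ ℓ₂ → RawRing c ℓ₁
scalars K = CommutativeRing.rawRing
  (HeytingCommutativeRing.commutativeRing (HeytingField.heytingCommutativeRing K))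

module _ (K : HeytingField c ℓ₁ ℓ₂) where

  open HeytingField K
  open RawMonoid (RawRing.+-rawMonoid (scalars K)) using () renaming (_×_ to _×′_)

  fromℕ : ℕ → Carrier
  fromℕ m = m ×′ 1#

  -- For a classical field x # 0# just says that x is not zero.
  CharacteristicZero : Set ℓ₂
  CharacteristicZero = ∀ m → .⦃ _ : NonZero m ⦄ → fromℕ m # 0#

module Eulerian (K : HeytingField c ℓ₁ ℓ₂) (char0 : CharacteristicZero K) where

  open HeytingField K

  -- Polynomials in t: coefficient lists, constant term first, considered up
  -- to trailing zeros.
  K[t] : Set c
  K[t] = List Carrier

  coeff : K[t] → ℕ → Carrier
  coeff []      _       = 0#
  coeff (x ∷ p) zero    = x
  coeff (x ∷ p) (suc k) = coeff p k

  infix  4 _≈ₚ_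
  infixl 6 _+ₚ_
  infixl 7 _*ₚ_

  _≈ₚ_ : Rel K[t] ℓ₁
  p ≈ₚ q = ∀ k → coeff p k ≈ coeff q k

  _+ₚ_ : K[t] → K[t] → K[t]
  []      +ₚ q       = q
  (x ∷ p) +ₚ []      = x ∷ p
  (x ∷ p) +ₚ (y ∷ q) = (x + y) ∷ (p +ₚ q)

  _*ₚ_ : K[t] → K[t] → K[t]
  []      *ₚ q = []
  (x ∷ p) *ₚ q = map (x *_) q +ₚ (0# ∷ p *ₚ q)

  const : Carrier → K[t]
  const x = x ∷ []

  t : K[t]
  t = 0# ∷ 1# ∷ []

  polynomials : RawRing c ℓ₁
  polynomials = record
    { Carrier = K[t]
    ; _≈_     = _≈ₚ_
    ; _+_     = _+ₚ_
    ; _*_     = _*ₚ_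
    ; -_      = map (λ x → - x)
    ; 0#      = []
    ; 1#      = const 1#
    }

  open RawSemiring (RawRing.rawSemiring polynomials) public using (_^_)

  -- #⇒invertible inverts m ! - 0#, i.e. m !.
  1/_! : ℕ → Carrier
  1/ m ! = proj₁ (#⇒invertible (char0 (m !) ⦃ ℕ._!≢0 m ⦄))

  fallingFactorial : K[t] → ℕ → K[t]
  fallingFactorial p zero    = const 1#
  fallingFactorial p (suc m) = fallingFactorial p m *ₚ (p +ₚ const (- fromℕ K m))

  binomial : K[t] → ℕ → K[t]
  binomial p m = const (1/ m !) *ₚ fallingFactorial p m

  module Scalar     = WQSym* (scalars K)
  module Polynomial = WQSym* polynomials

  extend : Scalar.WQSym n → Polynomial.WQSym n
  extend f u = const (f u)

  σ₁ᵗ : (n : ℕ) → Polynomial.WQSym n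
  σ₁ᵗ n = ∑[ u ← packedWords n ] binomial t (max (word u)) · N u
    where open Polynomial

  -- The coefficient of tᵏ in σ₁ᵗ n.  The expansion of σ₁ᵗ n as the sum of the
  -- tᵏ E n k over 1 ≤ k ≤ n needs 1 ≤ n: in degree 0 the sum is empty, but
  -- σ₁ᵗ 0 is the basis element of the empty word.
  E : (n k : ℕ) → Scalar.WQSym n
  E n k u = coeff (σ₁ᵗ n u) k

  U : PackedWord n → Polynomial.WQSym n
  U {n} v = σ₁ᵗ n ∗ N v
    where open Polynomial

{-# OPTIONS --safe #-}

-- The coefficient of N_w in (σ₁ᵗ)ₙ ∗ N_v is the sum of binomial t (max u) over
-- the packed words u with pack(u,v) = w.  There are none unless w ∈ WRef(v).
-- If w ∈ WRef(v), they arise from w by merging the blocks k and k + 1 for k in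
-- an arbitrary set of mergeable positions.  Deciding the positions one after
-- the other, from right to left, turns each mergeable position into one
-- application of Pascal's rule, so the sum is binomial (t + m) (max w), where m
-- is the number of mergeable positions.  Each step of the construction of
-- u₀(v,w) removes one block and one mergeable position, so m = max w − a₀(v,w).
--
-- The expansion in the Eulerian idempotents is a comparison of coefficients of
-- tᵏ: max u ≤ n bounds the degree, and the constant terms vanish for n ≥ 1.
module Submission where

open import Defs
open import Algebra.Apartness.Bundles using (HeytingField; module HeytingCommutativeRing)
open import Algebra.Bundles using (CommutativeRing)
open import Data.Bool.Base using (true; false; if_then_else_)
open import Data.Fin.Base as Fin using (Fin; toℕ)
import Data.Fin.Properties as Fin
open import Data.List.Base as List using (List; []; _∷_; foldr; map; upTo; length; filter; mapMaybe)
import Data.List.Membership.Propositional as List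
import Data.List.Membership.Propositional.Properties as List
import Data.List.Properties as List
open import Data.List.Relation.Unary.All as All using ([]; _∷_)
open import Data.List.Relation.Unary.AllPairs using ([]; _∷_)
open import Data.List.Relation.Unary.Any using (Any; here; there)
open import Data.List.Relation.Unary.Unique.Propositional using (Unique)
import Data.List.Relation.Unary.Unique.Propositional.Properties as Unique
open import Data.Maybe.Base as Maybe using (Maybe)
open import Data.Nat.Base as ℕ using (ℕ; zero; suc; _≤_; z≤n; s≤s; s≤s⁻¹; _∸_; _!)
open import Data.Nat.GeneralisedArithmetic using (fold)
import Data.Nat.Properties as ℕ
open import Data.Product.Base using (_×_; _,_; ∃; proj₁; proj₂)
open import Data.Sum.Base as Sum using (_⊎_; inj₁; inj₂)
open import Data.Vec.Base as Vec using (Vec; []; _∷_; lookup)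
open import Data.Vec.Membership.Propositional using (_∈_)
open import Data.Vec.Membership.Propositional.Properties using (∈-lookup)
import Data.Vec.Properties as Vec
import Data.Vec.Relation.Unary.Any as VecAny
import Data.Vec.Relation.Unary.Any.Properties as VecAny
open import Function.Base using (_∘_; case_of_)
open import Function.Bundles using (_⇔_; mk⇔; module Equivalence)
open import Level using (Level)
open import Relation.Binary.Core using (Rel)
open import Relation.Binary.Definitions using (tri<; tri≈; tri>)
open import Relation.Binary.PropositionalEquality as ≡ using (_≡_; _≢_)
open import Relation.Binary.Structures using (IsStrictTotalOrder)
open import Relation.Nullary using (Dec; yes; no; does; ¬_; contradiction)
open import Relation.Nullary.Decidable
  using (map′; _×-dec_; _⊎-dec_; _→-dec_; dec-true; dec-false; dec⇒maybe; does-⇔; recompute)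

-- The words `u` with pack(u,v) = `w` are not parametrised by sets of positions: `Coarsening`
-- describes them by order conditions alone, with a cut-off `k` to induct on. Going downwards
-- matters because merging at `suc k` relabels only higher blocks. Positions up to `k` keep their
-- names and, by transitivity of `<` through the nonempty block in between, their mergeability.
-- Hence the two branches `w` and `mergeAt (suc k) w` see the same count below the cut, while their
-- numbers of blocks differ by one: these are the two terms of Pascal's rule. The same argument,
-- applied also above the merge, shows that a merge of `u₀` costs exactly one mergeable position.

module PackedWords where

  open import Data.Nat.Base using (_<_; _+_)
  open import Data.Nat.Properties
  open import Relation.Binary.PropositionalEquality

  private variable
    a ℓ : Level
    n r : ℕ

  -- Packed words

  -- Positions and an explicit `r` replace membership and the existential of `IsPacked`: order
  -- conditions are stated on positions, and `mergeAt` lowers `r` by exactly one.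
  record Packed (r : ℕ) (w : Word n) : Set where
    constructor mkPacked
    field
      positive : ∀ i → 1 ≤ lookup w i
      bounded  : ∀ i → lookup w i ≤ r
      onto     : ∀ {k} → 1 ≤ k → k ≤ r → ∃ λ i → lookup w i ≡ k

  open Packed

  ∈⇒lookup : ∀ {k} {w : Word n} → k ∈ w → ∃ λ i → lookup w i ≡ k
  ∈⇒lookup k∈w = VecAny.index k∈w , sym (VecAny.lookup-index k∈w)

  lookup⇒∈ : ∀ {k} {w : Word n} → ∃ (λ i → lookup w i ≡ k) → k ∈ w
  lookup⇒∈ {w = w} (i , refl) = ∈-lookup i w

  lookup≤max : (w : Word n) → ∀ i → lookup w i ≤ max w
  lookup≤max w i = ∈⇒≤max w (∈-lookup i w)

  Packed⇒IsPacked : {w : Word n} → Packed r w → IsPacked w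
  Packed⇒IsPacked {r = r} {w = w} p = r , λ k → mk⇔
    (λ k∈w → case ∈⇒lookup k∈w of λ { (i , refl) → positive p i , bounded p i })
    (λ (1≤k , k≤r) → lookup⇒∈ {w = w} (onto p 1≤k k≤r))

  IsPacked⇒Packed : {w : Word n} → IsPacked w → Packed (max w) w
  IsPacked⇒Packed {w = w} (r , h) = mkPacked
    (λ i → proj₁ (Equivalence.to (h _) (∈-lookup i w)))
    (lookup≤max w)
    (λ 1≤k k≤max → ∈⇒lookup (Equivalence.from (h _) (1≤k , ≤-trans k≤max max≤r)))
    where
    max≤r : max w ≤ r
    max≤r = max≤ w (λ k∈w → proj₂ (Equivalence.to (h _) k∈w))

  Packed⇒max : {w : Word n} → Packed r w → max w ≡ r
  Packed⇒max {r = r} {w = w} p =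
    ≤-antisym (max≤ w (λ k∈w → case ∈⇒lookup k∈w of λ { (i , refl) → bounded p i })) (r≤ r p)
    where
    r≤ : ∀ r → Packed r w → r ≤ max w
    r≤ zero    _ = z≤n
    r≤ (suc r) p with i , eq ← onto p (s≤s z≤n) ≤-refl = subst (_≤ max w) eq (lookup≤max w i)

  word-packed : (u : PackedWord n) → Packed (max (word u)) (word u)
  -- The packedness proof is irrelevant, so a usable one is recomputed from the decision procedure.
  word-packed (packed w p) = IsPacked⇒Packed (recompute (isPacked? w) p)

  -- Choosing one occurrence of every letter embeds the letters into the positions.
  Packed⇒≤length : {w : Word n} → Packed r w → r ≤ n
  Packed⇒≤length {r = r} {w = w} p = Fin.injective⇒≤ {f = position} injective
    where
    occurrence : (k : Fin r) → ∃ λ i → lookup w i ≡ suc (toℕ k)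
    occurrence k = onto p (s≤s z≤n) (Fin.toℕ<n k)

    position : Fin r → Fin _
    position k = proj₁ (occurrence k)

    injective : ∀ {k l} → position k ≡ position l → k ≡ l
    injective {k} {l} eq = Fin.toℕ-injective (suc-injective
      (trans (sym (proj₂ (occurrence k))) (trans (cong (lookup w) eq) (proj₂ (occurrence l)))))

  -- A letter of a packed word is the length of a longest increasing chain of
  -- letters ending in it, so order-preserving maps can only increase letters.
  order-preserving⇒≤ : {w u : Word n} → Packed r w → (∀ i → 1 ≤ lookup u i) →
    (∀ i j → lookup w i < lookup w j → lookup u i < lookup u j) →
    ∀ i → lookup w i ≤ lookup u i
  order-preserving⇒≤ {w = w} {u} p 1≤u mono = λ i → go _ i refl
    where
    go : ∀ k i → lookup w i ≡ k → k ≤ lookup u i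
    go zero    i eq = z≤n
    go (suc k) i eq with k in k≡
    ... | zero   = 1≤u i
    ... | suc k′ with onto p (s≤s z≤n) (<⇒≤ (subst (_≤ _) eq (bounded p i)))
    ...   | j , wj≡ = ≤-<-trans (subst (_≤ lookup u j) k≡ (go k j (trans wj≡ (sym k≡))))
      (mono j i (subst₂ _<_ (sym wj≡) (sym eq) ≤-refl))

  -- Uniqueness of packing: `order-preserving⇒≤` bounds each word by the other. The reverse
  -- monotonicity follows by trichotomy, since a tie or a descent in `w` carries over to `u`.
  order-isomorphic⇒≡ : ∀ {r s} {w u : Word n} → Packed r w → Packed s u →
    (∀ i j → lookup w i ≡ lookup w j → lookup u i ≡ lookup u j) →
    (∀ i j → lookup w i < lookup w j → lookup u i < lookup u j) →
    w ≡ u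
  order-isomorphic⇒≡ {w = w} {u} pw pu eq mono = lookup-ext λ i →
    ≤-antisym (order-preserving⇒≤ {u = u} pw (positive pu) mono i) (order-preserving⇒≤ {u = w} pu (positive pw) mono⁻¹ i)
    where
    lookup-ext : ∀ {m} {x y : Word m} → (∀ i → lookup x i ≡ lookup y i) → x ≡ y
    lookup-ext {x = x} {y} h =
      trans (sym (Vec.tabulate∘lookup x)) (trans (Vec.tabulate-cong h) (Vec.tabulate∘lookup y))

    mono⁻¹ : ∀ i j → lookup u i < lookup u j → lookup w i < lookup w j
    mono⁻¹ i j ui<uj with <-cmp (lookup w i) (lookup w j)
    ... | tri< wi<wj _ _ = wi<wj
    ... | tri≈ _ wi≡wj _ = contradiction ui<uj (<-irrefl (eq i j wi≡wj))
    ... | tri> _ _ wj<wi = contradiction ui<uj (<-asym (mono j i wj<wi))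

  word-injective : {u v : PackedWord n} → word u ≡ word v → u ≡ v
  word-injective {u = packed _ _} {packed _ _} refl = refl

  -- The list of packed words

  -- The function under `mapMaybe` in `packedWords`, named so that inductions can run over an
  -- arbitrary list of words.
  packIfPacked : Word n → Maybe (PackedWord n)
  packIfPacked w = Maybe.map (λ p → packed w p) (dec⇒maybe (isPacked? w))

  wordsUpTo-unique : ∀ k n → Unique (wordsUpTo k n)
  wordsUpTo-unique k zero    = [] ∷ []
  wordsUpTo-unique k (suc n) = Unique.cartesianProductWith⁺ _∷_ Vec.∷-injective
    (Unique.map⁺ suc-injective (Unique.upTo⁺ k)) (wordsUpTo-unique k n)

  ∈-wordsUpTo : ∀ {k} (w : Word n) → (∀ i → 1 ≤ lookup w i × lookup w i ≤ k) → w List.∈ wordsUpTo k n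
  ∈-wordsUpTo []          h = here refl
  ∈-wordsUpTo (zero ∷ w)  h with () ← proj₁ (h Fin.zero)
  ∈-wordsUpTo (suc x ∷ w) h = List.∈-cartesianProductWith⁺ _∷_
    (List.∈-map⁺ suc (List.∈-upTo⁺ (proj₂ (h Fin.zero)))) (∈-wordsUpTo w (h ∘ Fin.suc))

  mapMaybe-packed-∈ : (ws : List (Word n)) {u : PackedWord n} →
    u List.∈ mapMaybe packIfPacked ws → word u List.∈ ws
  mapMaybe-packed-∈ (w ∷ ws) u∈ with isPacked? w
  mapMaybe-packed-∈ (w ∷ ws) (here refl) | yes _ = here refl
  mapMaybe-packed-∈ (w ∷ ws) (there u∈)  | yes _ = there (mapMaybe-packed-∈ ws u∈)
  mapMaybe-packed-∈ (w ∷ ws) u∈          | no _  = there (mapMaybe-packed-∈ ws u∈)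

  ∈-mapMaybe-packed : (ws : List (Word n)) (u : PackedWord n) →
    word u List.∈ ws → u List.∈ mapMaybe packIfPacked ws
  ∈-mapMaybe-packed (w ∷ ws) u u∈ with isPacked? w
  ∈-mapMaybe-packed (w ∷ ws) u (here eq)  | yes _ = here (word-injective eq)
  ∈-mapMaybe-packed (w ∷ ws) u (there u∈) | yes _ = there (∈-mapMaybe-packed ws u u∈)
  ∈-mapMaybe-packed (w ∷ ws) u (here refl) | no ¬p =
    contradiction (Packed⇒IsPacked (word-packed u)) ¬p
  ∈-mapMaybe-packed (w ∷ ws) u (there u∈) | no _ = ∈-mapMaybe-packed ws u u∈

  mapMaybe-packed-unique : {ws : List (Word n)} → Unique ws → Unique (mapMaybe packIfPacked ws)
  mapMaybe-packed-unique [] = []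
  mapMaybe-packed-unique {ws = w ∷ ws} (w∉ ∷ ws!) with isPacked? w
  ... | yes _ = All.tabulate (λ u∈ eq → All.lookup w∉ (mapMaybe-packed-∈ ws u∈) (cong word eq))
              ∷ mapMaybe-packed-unique ws!
  ... | no _  = mapMaybe-packed-unique ws!

  packedWords-unique : ∀ n → Unique (packedWords n)
  packedWords-unique n = mapMaybe-packed-unique (wordsUpTo-unique n n)

  ∈-packedWords : (u : PackedWord n) → u List.∈ packedWords n
  ∈-packedWords u = ∈-mapMaybe-packed _ u (∈-wordsUpTo (word u) λ i →
    positive (word-packed u) i , ≤-trans (bounded (word-packed u) i) (Packed⇒≤length (word-packed u)))

  -- Packing preserves and reflects the order of the letters

  module _ {A : Set a} {_≺_ : Rel A ℓ} (sto : IsStrictTotalOrder _≡_ _≺_) where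

    open Packing sto
    open IsStrictTotalOrder sto using (compare; irrefl; asym) renaming (_≟_ to _≟ᴬ_)

    rank-mono : ∀ {x y} bs → Sorted bs → Any (x ≡_) bs → Any (y ≡_) bs → x ≺ y → rank bs x < rank bs y
    rank-mono {x} {y} (b ∷ bs) (b≺ ∷ s) x∈ y∈ x≺y with x ≟ᴬ b | y ≟ᴬ b
    rank-mono (b ∷ bs) (b≺ ∷ s) x∈ y∈ x≺y         | yes refl | yes refl = contradiction x≺y (irrefl refl)
    rank-mono (b ∷ bs) (b≺ ∷ s) x∈ y∈ x≺y         | yes refl | no _ = s≤s (1≤rank bs _)
    rank-mono (b ∷ bs) (b≺ ∷ s) (here x≡b) y∈ x≺y | no x≢b | _ = contradiction x≡b x≢b
    rank-mono (b ∷ bs) (b≺ ∷ s) (there x∈) y∈ x≺y | no _ | yes refl =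
      contradiction x≺y (asym (All.lookup b≺ x∈))
    rank-mono (b ∷ bs) (b≺ ∷ s) x∈ (here y≡b) x≺y | no _ | no y≢b = contradiction y≡b y≢b
    rank-mono (b ∷ bs) (b≺ ∷ s) (there x∈) (there y∈) x≺y | no _ | no _ =
      s≤s (rank-mono bs s x∈ y∈ x≺y)

    packWord-cong : ∀ (z : Vec A n) i j → lookup z i ≡ lookup z j → lookup (packWord z) i ≡ lookup (packWord z) j
    packWord-cong z i j eq = trans (Vec.lookup-map i _ z) (trans (cong (rank (letters z)) eq) (sym (Vec.lookup-map j _ z)))

    packWord-mono : ∀ (z : Vec A n) i j → lookup z i ≺ lookup z j → lookup (packWord z) i < lookup (packWord z) j
    packWord-mono z i j zi≺zj = subst₂ _<_ (sym (Vec.lookup-map i _ z)) (sym (Vec.lookup-map j _ z))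
      (rank-mono (letters z) (letters-sorted z) (∈⇒∈letters z (∈-lookup i z)) (∈⇒∈letters z (∈-lookup j z)) zi≺zj)

    packWord-injective : ∀ (z : Vec A n) i j → lookup (packWord z) i ≡ lookup (packWord z) j → lookup z i ≡ lookup z j
    packWord-injective z i j eq with compare (lookup z i) (lookup z j)
    ... | tri< zi≺zj _ _ = contradiction eq (<⇒≢ (packWord-mono z i j zi≺zj))
    ... | tri≈ _ zi≡zj _ = zi≡zj
    ... | tri> _ _ zj≺zi = contradiction (sym eq) (<⇒≢ (packWord-mono z j i zj≺zi))

    packWord-cancel-< : ∀ (z : Vec A n) i j → lookup (packWord z) i < lookup (packWord z) j → lookup z i ≺ lookup z j
    packWord-cancel-< z i j lt with compare (lookup z i) (lookup z j)
    ... | tri< zi≺zj _ _ = zi≺zj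
    ... | tri≈ _ zi≡zj _ = contradiction lt (<-irrefl (packWord-cong z i j zi≡zj))
    ... | tri> _ _ zj≺zi = contradiction lt (<-asym (packWord-mono z j i zj≺zi))

  -- Coarsenings

  -- The word u arises from w by merging consecutive blocks among the first
  -- k + 1, where v has to increase strictly along the merged blocks.
  record Coarsening (v : Word n) (k : ℕ) (w u : Word n) : Set where
    constructor coarsening
    field
      coarser : ∀ i j → lookup w i ≡ lookup w j → lookup u i ≡ lookup u j
      ordered : ∀ i j → lookup w i < lookup w j →
        lookup u i < lookup u j ⊎ (lookup u i ≡ lookup u j × lookup v i < lookup v j × lookup w j ≤ suc k)

  open Coarsening

  coarsening? : (v : Word n) (k : ℕ) (w u : Word n) → Dec (Coarsening v k w u)
  coarsening? v k w u = map′ (λ (c , o) → coarsening c o) (λ g → coarser g , ordered g)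
    ((Fin.all? λ i → Fin.all? λ j → (lookup w i ≟ lookup w j) →-dec (lookup u i ≟ lookup u j))
     ×-dec
     (Fin.all? λ i → Fin.all? λ j → (lookup w i <? lookup w j) →-dec
       ((lookup u i <? lookup u j) ⊎-dec
        ((lookup u i ≟ lookup u j) ×-dec ((lookup v i <? lookup v j) ×-dec (lookup w j ≤? suc k))))))

  -- Equal letters of a packed biword come from equal biletters, hence from equal bottom letters.
  packBiword≡⇒∈WRef : (u v w : PackedWord n) → packBiword u v ≡ w → w ∈WRef v
  packBiword≡⇒∈WRef u v w refl i j eq = cong proj₂ (subst₂ _≡_
    (Vec.lookup-zip i (word u) (word v)) (Vec.lookup-zip j (word u) (word v))
    (packWord-injective <ˡᵉˣ-isStrictTotalOrder (Vec.zip (word u) (word v)) i j eq))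

  -- The two alternatives of `ordered` are those of the lexicographic order on biletters.
  -- Conversely, a coarsening together with `w ∈WRef v` makes `w` order-isomorphic to the biword,
  -- and packing is unique.
  packBiword≡⇔Coarsening : (u v w : PackedWord n) → w ∈WRef v →
    packBiword u v ≡ w ⇔ Coarsening (word v) (max (word w) ∸ 1) (word w) (word u)
  packBiword≡⇔Coarsening {n} u v w w∈ = mk⇔ to from
    where
    sto = <ˡᵉˣ-isStrictTotalOrder

    biword : Vec (ℕ × ℕ) n
    biword = Vec.zip (word u) (word v)

    lookup-biword : ∀ i → lookup biword i ≡ (lookup (word u) i , lookup (word v) i)
    lookup-biword i = Vec.lookup-zip i (word u) (word v)

    to : packBiword u v ≡ w → Coarsening (word v) (max (word w) ∸ 1) (word w) (word u)
    to refl = coarsening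
      (λ i j eq → cong proj₁ (subst₂ _≡_ (lookup-biword i) (lookup-biword j) (packWord-injective sto biword i j eq)))
      (λ i j lt → order i j (subst₂ _<ˡᵉˣ_ (lookup-biword i) (lookup-biword j) (packWord-cancel-< sto biword i j lt)))
      where
      order : ∀ i j → (lookup (word u) i , lookup (word v) i) <ˡᵉˣ (lookup (word u) j , lookup (word v) j) →
        lookup (word u) i < lookup (word u) j ⊎ (lookup (word u) i ≡ lookup (word u) j ×
          lookup (word v) i < lookup (word v) j × lookup (word w) j ≤ suc (max (word w) ∸ 1))
      order i j (inj₁ u<)        = inj₁ u<
      order i j (inj₂ (u≡ , v<)) = inj₂ (u≡ , v< ,
        -- The cut-off `max w ∸ 1` admits every letter: `max w ≤ suc (max w ∸ 1)` holds for the
        -- empty word too.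
        ≤-trans (lookup≤max (word w) j) (m≤n+m∸n (max (word w)) 1))

    from : Coarsening (word v) (max (word w) ∸ 1) (word w) (word u) → packBiword u v ≡ w
    from g = word-injective (sym (order-isomorphic⇒≡ (word-packed w) (word-packed (packBiword u v))
      (λ i j eq → packWord-cong sto biword i j (subst₂ _≡_ (sym (lookup-biword i)) (sym (lookup-biword j))
        (cong₂ _,_ (coarser g i j eq) (w∈ i j eq))))
      (λ i j lt → packWord-mono sto biword i j (subst₂ _<ˡᵉˣ_ (sym (lookup-biword i)) (sym (lookup-biword j))
        (order i j (ordered g i j lt))))))
      where
      order : ∀ i j → lookup (word u) i < lookup (word u) j ⊎ (lookup (word u) i ≡ lookup (word u) j ×
          lookup (word v) i < lookup (word v) j × lookup (word w) j ≤ suc (max (word w) ∸ 1)) →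
        (lookup (word u) i , lookup (word v) i) <ˡᵉˣ (lookup (word u) j , lookup (word v) j)
      order i j (inj₁ u<)            = inj₁ u<
      order i j (inj₂ (u≡ , v< , _)) = inj₂ (u≡ , v<)

  -- Merging consecutive blocks

  collapse : ℕ → ℕ → ℕ
  collapse k x = if does (x ≤? k) then x else x ∸ 1

  collapse-≤ : ∀ {k x} → x ≤ k → collapse k x ≡ x
  collapse-≤ {k} {x} x≤k = cong (if_then x else (x ∸ 1)) (dec-true (x ≤? k) x≤k)

  collapse-suc : ∀ {k x} → k ≤ x → collapse k (suc x) ≡ x
  collapse-suc {k} {x} k≤x = cong (if_then suc x else x) (dec-false (suc x ≤? k) (<⇒≱ (s≤s k≤x)))

  -- The fibres of `collapse k`. The alternatives overlap exactly in `y = k`, whose fibre consists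
  -- of `k` and `suc k`.
  collapse≡⇒ : ∀ {x y} k → collapse k x ≡ y → (x ≡ y × y ≤ k) ⊎ (x ≡ suc y × k ≤ y)
  collapse≡⇒ {x} k refl with x ≤? k
  ... | yes x≤k = inj₁ (sym (collapse-≤ x≤k) , subst (_≤ k) (sym (collapse-≤ x≤k)) x≤k)
  collapse≡⇒ {zero}  k refl | no x≰k = contradiction z≤n x≰k
  collapse≡⇒ {suc x} k refl | no x≰k = inj₂ (cong suc (sym eq) , subst (k ≤_) (sym eq) k≤x)
    where
    k≤x : k ≤ x
    k≤x = s≤s⁻¹ (≰⇒> x≰k)
    eq : collapse k (suc x) ≡ x
    eq = collapse-suc k≤x

  collapse-onto : ∀ k y → (y ≤ k × collapse k y ≡ y) ⊎ (k ≤ y × collapse k (suc y) ≡ y)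
  collapse-onto k y with ≤-total y k
  ... | inj₁ y≤k = inj₁ (y≤k , collapse-≤ y≤k)
  ... | inj₂ k≤y = inj₂ (k≤y , collapse-suc k≤y)

  collapse-mono-≤ : ∀ {x y} k → x ≤ y → collapse k x ≤ collapse k y
  collapse-mono-≤ {x} {y} k x≤y with collapse≡⇒ {x} k refl | collapse≡⇒ {y} k refl
  ... | inj₁ (x≡ , _)   | inj₁ (y≡ , _)  = subst₂ _≤_ x≡ y≡ x≤y
  ... | inj₁ (x≡ , x≤k) | inj₂ (y≡ , k≤) = ≤-trans x≤k k≤
  ... | inj₂ (x≡ , k≤)  | inj₁ (y≡ , y≤) =
    contradiction (≤-trans (subst₂ _≤_ x≡ y≡ x≤y) y≤) (<⇒≱ (s≤s k≤))
  ... | inj₂ (x≡ , _)   | inj₂ (y≡ , _)  = s≤s⁻¹ (subst₂ _≤_ x≡ y≡ x≤y)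

  collapse-cancel-< : ∀ {x y} k → collapse k x < collapse k y → x < y
  collapse-cancel-< {x} {y} k lt with x <? y
  ... | yes x<y = x<y
  ... | no x≮y  = contradiction lt (≤⇒≯ (collapse-mono-≤ k (≮⇒≥ x≮y)))

  collapse-< : ∀ {x y} k → x < y → collapse k x < collapse k y ⊎ (x ≡ k × y ≡ suc k)
  collapse-< {x} {y} k x<y with collapse≡⇒ {x} k refl | collapse≡⇒ {y} k refl
  ... | inj₁ (x≡ , _)   | inj₁ (y≡ , _)  = inj₁ (subst₂ _<_ x≡ y≡ x<y)
  ... | inj₂ (x≡ , _)   | inj₂ (y≡ , _)  = inj₁ (s≤s⁻¹ (subst₂ _<_ x≡ y≡ x<y))
  ... | inj₂ (x≡ , k≤)  | inj₁ (y≡ , y≤) =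
    contradiction (≤-trans (subst₂ _≤_ x≡ y≡ (<⇒≤ x<y)) y≤) (<⇒≱ (s≤s k≤))
  ... | inj₁ (x≡ , x≤k) | inj₂ (y≡ , k≤) with collapse k x <? collapse k y
  ...   | yes lt = inj₁ lt
  ...   | no ≮   = inj₂ (trans x≡ (≤-antisym x≤k (≤-trans k≤ (≮⇒≥ ≮))) ,
                         trans y≡ (cong suc (≤-antisym (≤-trans (≮⇒≥ ≮) x≤k) k≤)))

  lookup-mergeAt : ∀ k (w : Word n) i → lookup (mergeAt k w) i ≡ collapse k (lookup w i)
  lookup-mergeAt k w i = Vec.lookup-map i _ w

  mergeAt-merges : ∀ k (w : Word n) i j → lookup w i ≡ k → lookup w j ≡ suc k →
    lookup (mergeAt k w) i ≡ lookup (mergeAt k w) j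
  mergeAt-merges k w i j refl wj≡ = begin
    lookup (mergeAt k w) i   ≡⟨ lookup-mergeAt k w i ⟩
    collapse k k             ≡⟨ collapse-≤ (≤-refl {k}) ⟩
    k                        ≡⟨ collapse-suc (≤-refl {k}) ⟨
    collapse k (suc k)       ≡⟨ cong (collapse k) wj≡ ⟨
    collapse k (lookup w j)  ≡⟨ lookup-mergeAt k w j ⟨
    lookup (mergeAt k w) j   ∎
    where open ≡-Reasoning

  mergeAt-packed : ∀ {k} {w : Word n} → 1 ≤ k → k ≤ r → Packed (suc r) w → Packed r (mergeAt k w)
  mergeAt-packed {r = r} {k} {w} 1≤k k≤r p = mkPacked
    (λ i → subst (1 ≤_) (sym (lookup-mergeAt k w i)) (1≤ i))
    (λ i → subst (_≤ r) (sym (lookup-mergeAt k w i))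
      (≤-trans (collapse-mono-≤ k (bounded p i)) (≤-reflexive (collapse-suc k≤r))))
    λ {y} 1≤y y≤r → surj y 1≤y y≤r (collapse-onto k y)
    where
    1≤ : ∀ i → 1 ≤ collapse k (lookup w i)
    1≤ i with collapse≡⇒ {lookup w i} k refl
    ... | inj₁ (x≡ , _)  = subst (1 ≤_) x≡ (positive p i)
    ... | inj₂ (_ , k≤x) = ≤-trans 1≤k k≤x

    preimage : ∀ x {y} → 1 ≤ x → x ≤ suc r → collapse k x ≡ y → ∃ λ i → lookup (mergeAt k w) i ≡ y
    preimage x 1≤x x≤ eq with i , wi≡x ← onto p 1≤x x≤ =
      i , trans (lookup-mergeAt k w i) (trans (cong (collapse k) wi≡x) eq)

    surj : ∀ y → 1 ≤ y → y ≤ r → (y ≤ k × collapse k y ≡ y) ⊎ (k ≤ y × collapse k (suc y) ≡ y) →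
      ∃ λ i → lookup (mergeAt k w) i ≡ y
    surj y 1≤y y≤r (inj₁ (_ , eq)) = preimage y 1≤y (m≤n⇒m≤1+n y≤r) eq
    surj y 1≤y y≤r (inj₂ (_ , eq)) = preimage (suc y) (s≤s z≤n) (s≤s y≤r) eq

  module _ {v : Word n} {r k : ℕ} {w : Word n} (p : Packed (suc r) w) (1≤k : 1 ≤ k) (k≤r : k ≤ r)
           (mergeable : Mergeable v w k) where

    private
      lookup≡ : ∀ {x y} i → lookup w i ≡ x → collapse k x ≡ y → lookup (mergeAt k w) i ≡ y
      lookup≡ i wi≡x eq = trans (lookup-mergeAt k w i) (trans (cong (collapse k) wi≡x) eq)

      lookup≡⇒ : ∀ {y} i → lookup (mergeAt k w) i ≡ y →
        (lookup w i ≡ y × y ≤ k) ⊎ (lookup w i ≡ suc y × k ≤ y)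
      lookup≡⇒ i eq = collapse≡⇒ k (trans (sym (lookup-mergeAt k w i)) eq)

    -- Blocks up to `k` keep their labels, and block `k` grows by block `suc k`. Only the position
    -- just below `k` can notice, and there the new elements are reached by transitivity.
    mergeAt-Mergeable-below : ∀ {j} → j < k → Mergeable v (mergeAt k w) j ⇔ Mergeable v w j
    mergeAt-Mergeable-below {j} j<k = mk⇔
      (λ m i i′ wi≡ wi′≡ → m i i′ (lookup≡ i wi≡ (collapse-≤ (<⇒≤ j<k))) (lookup≡ i′ wi′≡ (collapse-≤ j<k)))
      (λ m i i′ wi≡ wi′≡ → from m i i′ (lookup≡⇒ i wi≡) (lookup≡⇒ i′ wi′≡))
      where
      from : Mergeable v w j → ∀ i i′ →
        (lookup w i ≡ j × j ≤ k) ⊎ (lookup w i ≡ suc j × k ≤ j) →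
        (lookup w i′ ≡ suc j × suc j ≤ k) ⊎ (lookup w i′ ≡ suc (suc j) × k ≤ suc j) →
        lookup v i < lookup v i′
      from m i i′ (inj₂ (_ , k≤j)) _                   = contradiction j<k (≤⇒≯ k≤j)
      from m i i′ (inj₁ (wi≡ , _)) (inj₁ (wi′≡ , _))   = m i i′ wi≡ wi′≡
      -- Here `k = suc j` and `i′` lies in the absorbed block; packedness supplies an element `x` of
      -- block `k` in between.
      from m i i′ (inj₁ (wi≡ , _)) (inj₂ (wi′≡ , k≤)) with onto p 1≤k (m≤n⇒m≤1+n k≤r) | ≤-antisym k≤ j<k
      ... | x , wx≡ | refl = <-trans (m i x wi≡ wx≡) (mergeable x i′ wx≡ wi′≡)

    -- The mirror image, with labels lowered by one. For `j = k` the lower block is the union, and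
    -- an element of block `suc k` serves as the intermediate one.
    mergeAt-Mergeable-above : ∀ {j} → k ≤ j → Mergeable v (mergeAt k w) j ⇔ Mergeable v w (suc j)
    mergeAt-Mergeable-above {j} k≤j = mk⇔
      (λ m i i′ wi≡ wi′≡ → m i i′ (lookup≡ i wi≡ (collapse-suc k≤j)) (lookup≡ i′ wi′≡ (collapse-suc (m≤n⇒m≤1+n k≤j))))
      (λ m i i′ wi≡ wi′≡ → from m i i′ (lookup≡⇒ i wi≡) (lookup≡⇒ i′ wi′≡))
      where
      from : Mergeable v w (suc j) → ∀ i i′ →
        (lookup w i ≡ j × j ≤ k) ⊎ (lookup w i ≡ suc j × k ≤ j) →
        (lookup w i′ ≡ suc j × suc j ≤ k) ⊎ (lookup w i′ ≡ suc (suc j) × k ≤ suc j) →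
        lookup v i < lookup v i′
      from m i i′ _                 (inj₁ (_ , j<k))  = contradiction j<k (≤⇒≯ k≤j)
      from m i i′ (inj₂ (wi≡ , _))  (inj₂ (wi′≡ , _)) = m i i′ wi≡ wi′≡
      from m i i′ (inj₁ (wi≡ , j≤)) (inj₂ (wi′≡ , _)) with onto p (s≤s z≤n) (s≤s k≤r) | ≤-antisym k≤j j≤
      ... | x , wx≡ | refl = <-trans (mergeable i x wi≡ wx≡) (m x i′ wx≡ wi′≡)

  -- The number of mergeable positions

  -- Peels off the largest position, as the induction on the cut-off does; `length-mergeable` links
  -- it to the ascending list used by `mergeLeftmost`.
  mergeableCount : Word n → Word n → ℕ → ℕ
  mergeableCount v w zero    = 0
  mergeableCount v w (suc m) = if does (mergeable? v w (suc m))
    then suc (mergeableCount v w m) else mergeableCount v w m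

  module _ {v : Word n} {r k : ℕ} {w : Word n} (p : Packed (suc r) w) (1≤k : 1 ≤ k) (k≤r : k ≤ r)
           (mergeable : Mergeable v w k) where

    mergeAt-count-below : ∀ m → m < k → mergeableCount v (mergeAt k w) m ≡ mergeableCount v w m
    mergeAt-count-below zero    _   = refl
    mergeAt-count-below (suc m) m<k = cong₂ (λ b c → if b then suc c else c)
      (does-⇔ (mergeAt-Mergeable-below {v = v} {w = w} p 1≤k k≤r mergeable m<k)
        (mergeable? v (mergeAt k w) (suc m)) (mergeable? v w (suc m)))
      (mergeAt-count-below m (<⇒≤ m<k))

    -- Position `k` itself is lost; the positions above survive one place lower, those below stay in
    -- place.
    mergeAt-count : ∀ m → k ≤ suc m → mergeableCount v w (suc m) ≡ suc (mergeableCount v (mergeAt k w) m)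
    mergeAt-count m k≤ with m≤n⇒m<n∨m≡n k≤
    mergeAt-count m       k≤ | inj₂ refl =
      trans (cong (if_then suc (mergeableCount v w m) else mergeableCount v w m) (dec-true (mergeable? v w k) mergeable))
            (cong suc (sym (mergeAt-count-below m ≤-refl)))
    mergeAt-count zero    k≤ | inj₁ (s≤s k≤0) = contradiction 1≤k (<⇒≱ (s≤s k≤0))
    mergeAt-count (suc m) k≤ | inj₁ (s≤s k≤m) = begin
      (if does (mergeable? v w (2 + m)) then suc (mergeableCount v w (suc m)) else mergeableCount v w (suc m))
        ≡⟨ cong₂ (λ b c → if b then suc c else c)
             (sym (does-⇔ (mergeAt-Mergeable-above {v = v} {w = w} p 1≤k k≤r mergeable k≤m)
               (mergeable? v (mergeAt k w) (suc m)) (mergeable? v w (2 + m))))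
             (mergeAt-count m k≤m) ⟩
      (if b then suc (suc c) else suc c)
        ≡⟨ if-suc b ⟩
      suc (if b then suc c else c) ∎
      where
      open ≡-Reasoning
      b = does (mergeable? v (mergeAt k w) (suc m))
      c = mergeableCount v (mergeAt k w) m
      if-suc : ∀ b → (if b then suc (suc c) else suc c) ≡ suc (if b then suc c else c)
      if-suc true  = refl
      if-suc false = refl

  -- Written exactly as the list scrutinised by `mergeLeftmost`, so that a `with` on it also reduces
  -- `mergeLeftmost`.
  mergeablePositions : Word n → Word n → List ℕ
  mergeablePositions v w = filter (mergeable? v w) (map suc (upTo (max w ∸ 1)))

  length-mergeable : (v w : Word n) → ∀ m → length (filter (mergeable? v w) (map suc (upTo m))) ≡ mergeableCount v w m
  length-mergeable v w zero    = refl
  length-mergeable v w (suc m) = begin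
    length (filter P? (map suc (upTo (suc m))))
      ≡⟨ cong (length ∘ filter P?) (trans (cong (map suc) (sym (List.upTo-∷ʳ m))) (List.map-++ suc (upTo m) (m ∷ []))) ⟩
    length (filter P? (map suc (upTo m) List.++ suc m ∷ []))
      ≡⟨ trans (cong length (List.filter-++ P? (map suc (upTo m)) _)) (List.length-++ (filter P? (map suc (upTo m)))) ⟩
    length (filter P? (map suc (upTo m))) + length (filter P? (suc m ∷ []))
      ≡⟨ cong (_+ length (filter P? (suc m ∷ []))) (length-mergeable v w m) ⟩
    mergeableCount v w m + length (filter P? (suc m ∷ []))
      ≡⟨ last ⟩
    mergeableCount v w (suc m) ∎
    where
    open ≡-Reasoning
    P? = mergeable? v w
    last : mergeableCount v w m + length (filter P? (suc m ∷ [])) ≡ mergeableCount v w (suc m)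
    last with does (P? (suc m))
    ... | true  = +-comm _ 1
    ... | false = +-identityʳ _

  -- The last equation says that r minus the count is invariant, without truncated
  -- subtraction.
  mergeLeftmost-count : (v w : Word n) → Packed r w → ∃ λ s → Packed s (mergeLeftmost v w) ×
    mergeableCount v (mergeLeftmost v w) (s ∸ 1) ≡ mergeableCount v w (r ∸ 1) ∸ 1 ×
    s + mergeableCount v w (r ∸ 1) ≡ r + mergeableCount v (mergeLeftmost v w) (s ∸ 1)
  mergeLeftmost-count {r = r} v w p with mergeablePositions v w in eq
  -- With nothing to merge the count is 0, and `0 ∸ 1` is again 0: idle rounds respect both
  -- equations.
  ... | [] = r , p , trans none (cong (_∸ 1) (sym none)) , refl
    where
    none : mergeableCount v w (r ∸ 1) ≡ 0
    none = trans (cong (mergeableCount v w ∘ (_∸ 1)) (sym (Packed⇒max p)))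
      (trans (sym (length-mergeable v w (max w ∸ 1))) (cong length eq))
  ... | k ∷ ks with k∈map , mergeable ←
        List.∈-filter⁻ (mergeable? v w) {xs = map suc (upTo (max w ∸ 1))} (subst (k List.∈_) (sym eq) (here refl))
               with k′ , k′∈upTo , refl ← List.∈-map⁻ suc k∈map =
    go r p (subst (λ m → k′ < m ∸ 1) (Packed⇒max p) (List.∈-upTo⁻ k′∈upTo))
    where
    go : ∀ r → Packed r w → k′ < r ∸ 1 → ∃ λ s → Packed s (mergeAt k w) ×
      mergeableCount v (mergeAt k w) (s ∸ 1) ≡ mergeableCount v w (r ∸ 1) ∸ 1 ×
      s + mergeableCount v w (r ∸ 1) ≡ r + mergeableCount v (mergeAt k w) (s ∸ 1)
    go (suc (suc r)) p k≤r = suc r , mergeAt-packed (s≤s z≤n) k≤r p ,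
      sym (cong (_∸ 1) count) , trans (cong (suc r +_) count) (+-suc (suc r) _)
      where
      count : mergeableCount v w (suc r) ≡ suc (mergeableCount v (mergeAt k w) r)
      count = mergeAt-count p (s≤s z≤n) k≤r mergeable r k≤r

  mergeableCount≤ : (v w : Word n) → ∀ m → mergeableCount v w m ≤ m
  mergeableCount≤ v w zero = z≤n
  mergeableCount≤ v w (suc m) with does (mergeable? v w (suc m))
  ... | true  = s≤s (mergeableCount≤ v w m)
  ... | false = m≤n⇒m≤1+n (mergeableCount≤ v w m)

  fold-mergeLeftmost : (v w : Word n) → Packed r w → ∀ m → ∃ λ s → Packed s (fold w (mergeLeftmost v) m) ×
    mergeableCount v (fold w (mergeLeftmost v) m) (s ∸ 1) ≡ mergeableCount v w (r ∸ 1) ∸ m ×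
    s + mergeableCount v w (r ∸ 1) ≡ r + mergeableCount v (fold w (mergeLeftmost v) m) (s ∸ 1)
  fold-mergeLeftmost {r = r} v w p zero = r , p , refl , refl
  fold-mergeLeftmost {r = r} v w p (suc m)
    with s , ps , count , total ← fold-mergeLeftmost v w p m
    with s′ , ps′ , count′ , total′ ← mergeLeftmost-count v _ ps =
    s′ , ps′ , trans count′ (trans (cong (_∸ 1) count) (trans (∸-+-assoc c m 1) (cong (c ∸_) (+-comm m 1)))) ,
    -- The invariants of the first `m` rounds and of the last one share the intermediate count `cₘ`;
    -- they are chained with it added on both sides and then cancelled.
    +-cancelʳ-≡ cₘ (s′ + c) (r + c′) (begin
      s′ + c + cₘ   ≡⟨ swap s′ c cₘ ⟩
      s′ + cₘ + c   ≡⟨ cong (_+ c) total′ ⟩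
      s + c′ + c    ≡⟨ swap s c′ c ⟩
      s + c + c′    ≡⟨ cong (_+ c′) total ⟩
      r + cₘ + c′   ≡⟨ swap r cₘ c′ ⟩
      r + c′ + cₘ   ∎)
    where
    open ≡-Reasoning
    c = mergeableCount v w (r ∸ 1)
    cₘ = mergeableCount v (fold w (mergeLeftmost v) m) (s ∸ 1)
    c′ = mergeableCount v (fold w (mergeLeftmost v) (suc m)) (s′ ∸ 1)
    swap : ∀ x y z → x + y + z ≡ x + z + y
    swap x y z = trans (+-assoc x y z) (trans (cong (x +_) (+-comm y z)) (sym (+-assoc x z y)))

  -- There are at most `max w ∸ 1` mergeable positions, so `max w` rounds bring the count to 0, and
  -- the invariant becomes this equation.
  a₀+mergeableCount : (v w : PackedWord n) →
    a₀ v w + mergeableCount (word v) (word w) (max (word w) ∸ 1) ≡ max (word w)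
  a₀+mergeableCount v w
    with s , ps , count , total ← fold-mergeLeftmost (word v) (word w) (word-packed w) (max (word w)) =
    trans (cong (_+ _) (Packed⇒max ps)) (trans total (trans
      (cong (max (word w) +_) (trans count (m≤n⇒m∸n≡0 {c} {max (word w)}
      (≤-trans (mergeableCount≤ (word v) (word w) (max (word w) ∸ 1)) (m∸n≤m _ 1))))) (+-identityʳ _)))
    where
    c = mergeableCount (word v) (word w) (max (word w) ∸ 1)

  -- Coarsenings that merge the blocks k and k + 1

  -- At cut-off 0 a tie in `u` between different blocks would need `lookup w i < lookup w j ≤ 1`,
  -- which positivity of the letters forbids.
  Coarsening-zero : {v w u : Word n} → ∀ {r s} → Packed r w → Packed s u → Coarsening v 0 w u ⇔ (u ≡ w)
  Coarsening-zero {v = v} {w} {u} pw pu = mk⇔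
    (λ g → sym (order-isomorphic⇒≡ pw pu (coarser g) (λ i j lt → strict i j lt (ordered g i j lt))))
    λ { refl → coarsening (λ _ _ eq → eq) (λ _ _ lt → inj₁ lt) }
    where
    strict : ∀ i j → lookup w i < lookup w j →
      lookup u i < lookup u j ⊎ (lookup u i ≡ lookup u j × lookup v i < lookup v j × lookup w j ≤ 1) →
      lookup u i < lookup u j
    strict i j lt (inj₁ u<)             = u<
    strict i j lt (inj₂ (_ , _ , wj≤1)) = contradiction (≤-trans lt wj≤1) (<⇒≱ (s≤s (positive pw i)))

  Coarsening-suc : {v w u : Word n} → ∀ {k} → Coarsening v k w u → Coarsening v (suc k) w u
  Coarsening-suc g = coarsening (coarser g) λ i j lt → case ordered g i j lt of λ where
    (inj₁ u<)             → inj₁ u<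
    (inj₂ (u≡ , v< , w≤)) → inj₂ (u≡ , v< , m≤n⇒m≤1+n w≤)

  module _ {v w u : Word n} {r k : ℕ} (p : Packed (suc r) w) (k<r : suc k ≤ r) where

    private
      lower : ∃ λ i → lookup w i ≡ suc k
      lower = onto p (s≤s z≤n) (m≤n⇒m≤1+n k<r)

      upper : ∃ λ i → lookup w i ≡ suc (suc k)
      upper = onto p (s≤s z≤n) (s≤s k<r)

      lower<upper : lookup w (proj₁ lower) < lookup w (proj₁ upper)
      lower<upper = subst₂ _<_ (sym (proj₂ lower)) (sym (proj₂ upper)) ≤-refl

      w′ : Word n
      w′ = mergeAt (suc k) w

      w′≡ : ∀ i → lookup w′ i ≡ collapse (suc k) (lookup w i)
      w′≡ = lookup-mergeAt (suc k) w

    -- Block `suc (suc k)` lies beyond the cut-off, so a tie is excluded. With `Coarsening-merged`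
    -- this makes the alternatives of `Coarsening-split` disjoint.
    Coarsening-separated : Coarsening v k w u → lookup u (proj₁ lower) < lookup u (proj₁ upper)
    Coarsening-separated g with ordered g _ _ lower<upper
    ... | inj₁ u<           = u<
    ... | inj₂ (_ , _ , w≤) = contradiction w≤ (<⇒≱ (≤-reflexive (sym (proj₂ upper))))

    Coarsening-merged : Coarsening v k w′ u → lookup u (proj₁ lower) ≡ lookup u (proj₁ upper)
    Coarsening-merged g = coarser g _ _ (mergeAt-merges (suc k) w _ _ (proj₂ lower) (proj₂ upper))

    -- The only new tie joins blocks `suc k` and `suc (suc k)`: mergeability provides the increase
    -- of `v`, and the raised cut-off is just met.
    Coarsening-mergeAt⁻ : Mergeable v w (suc k) → Coarsening v k w′ u → Coarsening v (suc k) w u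
    Coarsening-mergeAt⁻ mergeable g = coarsening
      (λ i j eq → coarser g i j (trans (w′≡ i) (trans (cong (collapse (suc k)) eq) (sym (w′≡ j)))))
      order
      where
      order : ∀ i j → lookup w i < lookup w j → lookup u i < lookup u j ⊎
        (lookup u i ≡ lookup u j × lookup v i < lookup v j × lookup w j ≤ suc (suc k))
      order i j lt with collapse-< (suc k) lt
      ... | inj₂ (wi≡ , wj≡) =
        inj₂ (coarser g i j (mergeAt-merges (suc k) w i j wi≡ wj≡) , mergeable i j wi≡ wj≡ , ≤-reflexive wj≡)
      ... | inj₁ lt′ with ordered g i j (subst₂ _<_ (sym (w′≡ i)) (sym (w′≡ j)) lt′)
      ...   | inj₁ u< = inj₁ u<
      ...   | inj₂ (u≡ , v< , w′≤) = inj₂ (u≡ , v< , wj≤)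
        where
        wj≤ : lookup w j ≤ suc (suc k)
        wj≤ with collapse≡⇒ {lookup w j} (suc k) (sym (w′≡ j))
        ... | inj₁ (wj≡ , _) = ≤-trans (≤-reflexive wj≡) (m≤n⇒m≤1+n w′≤)
        ... | inj₂ (wj≡ , _) = ≤-trans (≤-reflexive wj≡) (s≤s w′≤)

    -- Since `u` is constant on blocks of `w`, comparing it at `lower` and `upper` decides the case.
    -- A tie there can only come from the second alternative of `ordered`, which also yields
    -- mergeability.
    Coarsening-split : Coarsening v (suc k) w u →
      Coarsening v k w u ⊎ (Mergeable v w (suc k) × Coarsening v k w′ u)
    Coarsening-split g with ordered g _ _ lower<upper
    ... | inj₁ lower<u = inj₁ (coarsening (coarser g) order)
      where
      order : ∀ i j → lookup w i < lookup w j → lookup u i < lookup u j ⊎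
        (lookup u i ≡ lookup u j × lookup v i < lookup v j × lookup w j ≤ suc k)
      order i j lt with ordered g i j lt
      ... | inj₁ u< = inj₁ u<
      ... | inj₂ (u≡ , v< , wj≤) with m≤n⇒m<n∨m≡n wj≤
      ...   | inj₁ wj<  = inj₂ (u≡ , v< , s≤s⁻¹ wj<)
      -- Here `j` lies in block `suc (suc k)`. On all smaller blocks `u` is at most its value at
      -- `lower`, which is strictly below `u j`, so the strict alternative holds.
      ...   | inj₂ wj≡ = inj₁ (<-≤-trans (≤-<-trans ui≤ lower<u)
                (≤-reflexive (coarser g _ _ (trans (proj₂ upper) (sym wj≡)))))
        where
        ui≤ : lookup u i ≤ lookup u (proj₁ lower)
        ui≤ with m≤n⇒m<n∨m≡n (s≤s⁻¹ (subst (lookup w i <_) wj≡ lt))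
        ... | inj₂ wi≡ = ≤-reflexive (coarser g _ _ (trans wi≡ (sym (proj₂ lower))))
        ... | inj₁ wi< with ordered g i (proj₁ lower) (subst (lookup w i <_) (sym (proj₂ lower)) wi<)
        ...   | inj₁ u<      = <⇒≤ u<
        ...   | inj₂ (u≡ , _) = ≤-reflexive u≡
    ... | inj₂ (u≡ , _ , _) = inj₂ (mergeable , coarsening coarse order)
      where
      u≡-blocks : ∀ i j → lookup w i ≡ suc k → lookup w j ≡ suc (suc k) → lookup u i ≡ lookup u j
      u≡-blocks i j wi≡ wj≡ = trans (coarser g _ _ (trans wi≡ (sym (proj₂ lower))))
        (trans u≡ (coarser g _ _ (trans (proj₂ upper) (sym wj≡))))

      mergeable : Mergeable v w (suc k)
      mergeable i j wi≡ wj≡ with ordered g i j (subst₂ _<_ (sym wi≡) (sym wj≡) ≤-refl)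
      ... | inj₁ u<           = contradiction u< (<-irrefl (u≡-blocks i j wi≡ wj≡))
      ... | inj₂ (_ , v< , _) = v<

      coarse : ∀ i j → lookup w′ i ≡ lookup w′ j → lookup u i ≡ lookup u j
      coarse i j eq with <-cmp (lookup w i) (lookup w j)
      ... | tri≈ _ wi≡wj _ = coarser g i j wi≡wj
      ... | tri< lt _ _ with collapse-< (suc k) lt
      ...   | inj₁ lt′          = contradiction eq (<⇒≢ (subst₂ _<_ (sym (w′≡ i)) (sym (w′≡ j)) lt′))
      ...   | inj₂ (wi≡ , wj≡) = u≡-blocks i j wi≡ wj≡
      coarse i j eq | tri> _ _ gt with collapse-< (suc k) gt
      ...   | inj₁ gt′          = contradiction (sym eq) (<⇒≢ (subst₂ _<_ (sym (w′≡ j)) (sym (w′≡ i)) gt′))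
      ...   | inj₂ (wj≡ , wi≡) = sym (u≡-blocks j i wj≡ wi≡)

      order : ∀ i j → lookup w′ i < lookup w′ j → lookup u i < lookup u j ⊎
        (lookup u i ≡ lookup u j × lookup v i < lookup v j × lookup w′ j ≤ suc k)
      order i j lt with ordered g i j (collapse-cancel-< (suc k) (subst₂ _<_ (w′≡ i) (w′≡ j) lt))
      ... | inj₁ u<              = inj₁ u<
      ... | inj₂ (u≡ , v< , wj≤) = inj₂ (u≡ , v< , ≤-trans (≤-reflexive (w′≡ j))
            (≤-trans (collapse-mono-≤ (suc k) wj≤) (≤-reflexive (collapse-suc (≤-refl {suc k})))))

open PackedWords

-- Sums over lists and the internal product with a basis element

module Sums {c ℓ : Level} (R : CommutativeRing c ℓ) where

  open CommutativeRing R
  open WQSym* rawRing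
  open import Relation.Binary.Reasoning.Setoid setoid
  open import Algebra.Properties.CommutativeSemigroup +-commutativeSemigroup using (interchange)

  private variable
    i p q s : Level
    I : Set i
    n : ℕ

  sum : List I → (I → Carrier) → Carrier
  sum xs f = foldr (λ x s → f x + s) 0# xs

  ∑-apply : (xs : List I) (f : I → WQSym n) (u : PackedWord n) → (∑ xs f) u ≡ sum xs (λ x → f x u)
  ∑-apply []       f u = ≡.refl
  ∑-apply (x ∷ xs) f u = ≡.cong (f x u +_) (∑-apply xs f u)

  sum-cong : (xs : List I) {f g : I → Carrier} → (∀ x → f x ≈ g x) → sum xs f ≈ sum xs g
  sum-cong []       f≈g = refl
  sum-cong (x ∷ xs) f≈g = +-cong (f≈g x) (sum-cong xs f≈g)

  sum-+ : (xs : List I) {f g : I → Carrier} → sum xs (λ x → f x + g x) ≈ sum xs f + sum xs g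
  sum-+ []       = sym (+-identityˡ 0#)
  sum-+ (x ∷ xs) = trans (+-congˡ (sum-+ xs)) (interchange _ _ _ _)

  sum-zero : (xs : List I) {f : I → Carrier} → (∀ {x} → x List.∈ xs → f x ≈ 0#) → sum xs f ≈ 0#
  sum-zero []       f≈0 = refl
  sum-zero (x ∷ xs) f≈0 = trans (+-cong (f≈0 (here ≡.refl)) (sum-zero xs (f≈0 ∘ there))) (+-identityˡ 0#)

  sum-single : {xs : List I} {f : I → Carrier} {y : I} → Unique xs → y List.∈ xs →
    (∀ {x} → x ≢ y → f x ≈ 0#) → sum xs f ≈ f y
  sum-single {xs = x ∷ xs} (x∉ ∷ _) (here ≡.refl) f≈0 =
    trans (+-congˡ (sum-zero xs λ z∈ → f≈0 (All.lookup x∉ z∈ ∘ ≡.sym))) (+-identityʳ _)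
  sum-single (x∉ ∷ xs!) (there y∈) f≈0 =
    trans (+-cong (f≈0 (All.lookup x∉ y∈)) (sum-single xs! y∈ f≈0)) (+-identityˡ _)

  infixr 8 ⟦_⟧_
  -- The Iverson bracket. It inspects only `does P?`, so equivalent decisions give equal values.
  ⟦_⟧_ : {P : Set p} → Dec P → Carrier → Carrier
  ⟦ P? ⟧ x = if does P? then x else 0#

  ⟦⟧-cong : {P : Set p} (P? : Dec P) {x y : Carrier} → x ≈ y → ⟦ P? ⟧ x ≈ ⟦ P? ⟧ y
  ⟦⟧-cong P? x≈y with does P?
  ... | true  = x≈y
  ... | false = refl

  ⟦⟧-⇔ : {P : Set p} {Q : Set q} (P? : Dec P) (Q? : Dec Q) {x : Carrier} → P ⇔ Q → ⟦ P? ⟧ x ≈ ⟦ Q? ⟧ x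
  ⟦⟧-⇔ P? Q? {x} P⇔Q = reflexive (≡.cong (if_then x else 0#) (does-⇔ P⇔Q P? Q?))

  ⟦⟧-true : {P : Set p} (P? : Dec P) {x : Carrier} → P → ⟦ P? ⟧ x ≈ x
  ⟦⟧-true P? {x} p = reflexive (≡.cong (if_then x else 0#) (dec-true P? p))

  ⟦⟧-false : {P : Set p} (P? : Dec P) {x : Carrier} → ¬ P → ⟦ P? ⟧ x ≈ 0#
  ⟦⟧-false P? {x} ¬p = reflexive (≡.cong (if_then x else 0#) (dec-false P? ¬p))

  ⟦⟧-disjoint : {P : Set p} {Q : Set q} {S : Set s} (P? : Dec P) (Q? : Dec Q) (S? : Dec S) {x : Carrier} →
    (P → Q ⊎ S) → (Q ⊎ S → P) → (Q → ¬ S) → ⟦ P? ⟧ x ≈ ⟦ Q? ⟧ x + ⟦ S? ⟧ x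
  ⟦⟧-disjoint P? (yes q) (yes s) to from disjoint = contradiction s (disjoint q)
  ⟦⟧-disjoint P? (yes q) (no _)  to from disjoint = trans (⟦⟧-true P? (from (inj₁ q))) (sym (+-identityʳ _))
  ⟦⟧-disjoint P? (no _)  (yes s) to from disjoint = trans (⟦⟧-true P? (from (inj₂ s))) (sym (+-identityˡ _))
  ⟦⟧-disjoint P? (no ¬q) (no ¬s) to from disjoint = trans (⟦⟧-false P? (Sum.[ ¬q , ¬s ] ∘ to)) (sym (+-identityˡ _))

  *-N : ∀ x (u v : PackedWord n) → x * N u v ≈ ⟦ u ≟ᵖ v ⟧ x
  *-N x u v = trans (*-congˡ (reflexive indicator)) (multiple (u ≟ᵖ v))
    where
    indicator : N u v ≡ ⟦ u ≟ᵖ v ⟧ 1#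
    indicator with u ≟ᵖ v
    ... | yes u≡v = ≡.sym (≡.cong (if_then 1# else 0#) (dec-true (u ≟ᵖ v) u≡v))
    ... | no  u≢v = ≡.sym (≡.cong (if_then 1# else 0#) (dec-false (u ≟ᵖ v) u≢v))

    multiple : {P : Set} (P? : Dec P) → x * ⟦ P? ⟧ 1# ≈ ⟦ P? ⟧ x
    multiple P? with does P?
    ... | true  = *-identityʳ x
    ... | false = zeroʳ x

  ∑-N : {xs : List (PackedWord n)} {f : PackedWord n → Carrier} {u : PackedWord n} →
    Unique xs → u List.∈ xs → (∑ xs (λ x → f x · N x)) u ≈ f u
  ∑-N {xs = xs} {f} {u} xs! u∈ = begin
    (∑ xs (λ x → f x · N x)) u     ≡⟨ ∑-apply xs (λ x → f x · N x) u ⟩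
    sum xs (λ x → f x * N x u)     ≈⟨ sum-single xs! u∈ (λ {x} x≢u → trans (*-N _ x u) (⟦⟧-false (x ≟ᵖ u) x≢u)) ⟩
    f u * N u u                    ≈⟨ *-N _ u u ⟩
    ⟦ u ≟ᵖ u ⟧ f u                 ≈⟨ ⟦⟧-true (u ≟ᵖ u) ≡.refl ⟩
    f u                            ∎

  ∑-N-∉ : {xs : List (PackedWord n)} {f : PackedWord n → Carrier} {u : PackedWord n} →
    ¬ (u List.∈ xs) → (∑ xs (λ x → f x · N x)) u ≈ 0#
  ∑-N-∉ {xs = xs} {f} {u} u∉ = trans (reflexive (∑-apply xs (λ x → f x · N x) u))
    (sum-zero xs λ {x} x∈ → trans (*-N _ x u) (⟦⟧-false (x ≟ᵖ u) λ { ≡.refl → u∉ x∈ }))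

  -- The factor `N v` keeps only the term `v′ = v` of the inner sum.
  ∗-N : (f : WQSym n) (v w : PackedWord n) →
    (f ∗ N v) w ≈ sum (packedWords n) (λ u → ⟦ packBiword u v ≟ᵖ w ⟧ f u)
  ∗-N {n} f v w = trans (reflexive (∑-apply (packedWords n) _ w)) (sum-cong (packedWords n) inner)
    where
    inner : ∀ u → (∑ (packedWords n) λ v′ → (f u * N v v′) · N (packBiword u v′)) w ≈ ⟦ packBiword u v ≟ᵖ w ⟧ f u
    inner u = begin
      (∑ (packedWords n) λ v′ → (f u * N v v′) · N (packBiword u v′)) w
        ≡⟨ ∑-apply (packedWords n) _ w ⟩
      sum (packedWords n) (λ v′ → (f u * N v v′) * N (packBiword u v′) w)
        ≈⟨ sum-single (packedWords-unique n) (∈-packedWords v) (λ {v′} v′≢v →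
             trans (*-congʳ (trans (*-N _ v v′) (⟦⟧-false (v ≟ᵖ v′) (v′≢v ∘ ≡.sym)))) (zeroˡ _)) ⟩
      (f u * N v v) * N (packBiword u v) w
        ≈⟨ *-congʳ (trans (*-N _ v v) (⟦⟧-true (v ≟ᵖ v) ≡.refl)) ⟩
      f u * N (packBiword u v) w
        ≈⟨ *-N _ (packBiword u v) w ⟩
      ⟦ packBiword u v ≟ᵖ w ⟧ f u ∎

  -- The sum over coarsenings, from Pascal's rule

  module _ (B : ℕ → ℕ → Carrier) (pascal : ∀ m r → B (suc m) (suc r) ≈ B m (suc r) + B m r) where

    -- `B m r` stands for the binomial coefficient of `t + m` over `r`, so `B 0` is the weight of a
    -- word in `σ₁ᵗ`.
    coarseningSum : Word n → ℕ → Word n → Carrier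
    coarseningSum {n} v k w = sum (packedWords n) λ u → ⟦ coarsening? v k w (word u) ⟧ B 0 (max (word u))

    coarseningSum-zero : ∀ (v : Word n) {r} {w} → Packed r w → coarseningSum v 0 w ≈ B 0 r
    coarseningSum-zero {n} v {r} {w} p = begin
      coarseningSum v 0 w
        ≈⟨ sum-single (packedWords-unique n) (∈-packedWords w̃) (λ {u} u≢w → ⟦⟧-false (coarsening? v 0 w (word u))
             (u≢w ∘ word-injective ∘ Equivalence.to (Coarsening-zero {v = v} p (word-packed u)))) ⟩
      ⟦ coarsening? v 0 w w ⟧ B 0 (max w)
        ≈⟨ ⟦⟧-true (coarsening? v 0 w w) (Equivalence.from (Coarsening-zero {v = v} p p) ≡.refl) ⟩
      B 0 (max w)
        ≡⟨ ≡.cong (B 0) (Packed⇒max p) ⟩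
      B 0 r ∎
      where
      w̃ : PackedWord n
      w̃ = packed w (Packed⇒IsPacked p)

    module _ {n} {v : Word n} {r k : ℕ} {w : Word n} (p : Packed (suc r) w) (k<r : suc k ℕ.≤ r) where

      private
        summand : ℕ → Word n → PackedWord n → Carrier
        summand k w u = ⟦ coarsening? v k w (word u) ⟧ B 0 (max (word u))

        w′ : Word n
        w′ = mergeAt (suc k) w

      coarseningSum-mergeable : Mergeable v w (suc k) →
        coarseningSum v (suc k) w ≈ coarseningSum v k w + coarseningSum v k w′
      coarseningSum-mergeable mergeable = trans (sum-cong (packedWords n) split) (sum-+ (packedWords n))
        where
        split : ∀ u → summand (suc k) w u ≈ summand k w u + summand k w′ u
        split u = ⟦⟧-disjoint (coarsening? v (suc k) w (word u)) (coarsening? v k w (word u)) (coarsening? v k w′ (word u))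
          (Sum.map₂ proj₂ ∘ Coarsening-split p k<r)
          (Sum.[ Coarsening-suc , Coarsening-mergeAt⁻ {v = v} p k<r mergeable ])
          λ g g′ → ℕ.<⇒≢ (Coarsening-separated {v = v} p k<r g) (Coarsening-merged {v = v} p k<r g′)

      coarseningSum-unmergeable : ¬ Mergeable v w (suc k) → coarseningSum v (suc k) w ≈ coarseningSum v k w
      coarseningSum-unmergeable ¬mergeable = sum-cong (packedWords n) λ u →
        ⟦⟧-⇔ (coarsening? v (suc k) w (word u)) (coarsening? v k w (word u)) (mk⇔ to Coarsening-suc)
        where
        to : ∀ {u} → Coarsening v (suc k) w u → Coarsening v k w u
        to g with Coarsening-split p k<r g
        ... | inj₁ g′              = g′
        ... | inj₂ (mergeable , _) = contradiction mergeable ¬mergeable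

    -- Induction on the cut-off: the last position contributes a Pascal step if mergeable and leaves
    -- the sum unchanged otherwise. `k ≤ r ∸ 1` ensures that the block after position `k` exists.
    coarseningSum≈ : ∀ (v : Word n) k {r w} → Packed r w → k ℕ.≤ r ∸ 1 →
      coarseningSum v k w ≈ B (mergeableCount v w k) r
    coarseningSum≈ v zero    p _ = coarseningSum-zero v p
    coarseningSum≈ v (suc k) {suc (suc r)} {w} p k≤r@(s≤s k≤r′) = go (mergeable? v w (suc k))
      where
      m = mergeableCount v w k

      go : Dec (Mergeable v w (suc k)) → coarseningSum v (suc k) w ≈ B (mergeableCount v w (suc k)) (suc (suc r))
      go (yes mergeable) = begin
        coarseningSum v (suc k) w
          ≈⟨ coarseningSum-mergeable {v = v} p k≤r mergeable ⟩
        coarseningSum v k w + coarseningSum v k (mergeAt (suc k) w)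
          ≈⟨ +-cong (coarseningSum≈ v k p (ℕ.m≤n⇒m≤1+n k≤r′))
                    (coarseningSum≈ v k (mergeAt-packed (s≤s z≤n) k≤r p) k≤r′) ⟩
        B m (suc (suc r)) + B (mergeableCount v (mergeAt (suc k) w) k) (suc r)
          -- Counts below the merge agree, so both terms share the upper argument `m`.
          ≡⟨ ≡.cong (λ m′ → B m (suc (suc r)) + B m′ (suc r))
               (mergeAt-count-below {v = v} p (s≤s z≤n) k≤r mergeable k ℕ.≤-refl) ⟩
        B m (suc (suc r)) + B m (suc r)
          ≈⟨ pascal _ _ ⟨
        B (suc m) (suc (suc r))
          ≡⟨ ≡.cong (λ b → B (if b then suc m else m) (suc (suc r))) (dec-true (mergeable? v w (suc k)) mergeable) ⟨
        B (mergeableCount v w (suc k)) (suc (suc r)) ∎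
      go (no ¬mergeable) = begin
        coarseningSum v (suc k) w
          ≈⟨ coarseningSum-unmergeable {v = v} p k≤r ¬mergeable ⟩
        coarseningSum v k w
          ≈⟨ coarseningSum≈ v k p (ℕ.m≤n⇒m≤1+n k≤r′) ⟩
        B m (suc (suc r))
          ≡⟨ ≡.cong (λ b → B (if b then suc m else m) (suc (suc r))) (dec-false (mergeable? v w (suc k)) ¬mergeable) ⟨
        B (mergeableCount v w (suc k)) (suc (suc r)) ∎

-- Binomial coefficients and polynomials

module BinomialCoefficients {c ℓ : Level} (R : CommutativeRing c ℓ) where

  open CommutativeRing R
  open import Algebra.Solver.Ring.NaturalCoefficients.Default commutativeSemiring
  open import Relation.Binary.Reasoning.Setoid setoid

  -- d m stands for − m and e m for 1 / m !.
  module Factors (d e : ℕ → Carrier) (d-zero : d 0 ≈ 0#) (d-suc : ∀ m → 1# + d (suc m) ≈ d m)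
                 (e-suc : ∀ m → e m + e (suc m) * d (suc m) ≈ 0#) where

    falling : Carrier → ℕ → Carrier
    falling x zero    = 1#
    falling x (suc m) = falling x m * (x + d m)

    binom : Carrier → ℕ → Carrier
    binom x m = e m * falling x m

    falling-cong : ∀ {x y} m → x ≈ y → falling x m ≈ falling y m
    falling-cong zero    x≈y = refl
    falling-cong (suc m) x≈y = *-cong (falling-cong m x≈y) (+-congʳ x≈y)

    binom-cong : ∀ {x y} m → x ≈ y → binom x m ≈ binom y m
    binom-cong m x≈y = *-congˡ (falling-cong m x≈y)

    -- Raising `x` by one turns each factor into the preceding one, because `1# + d (suc m) ≈ d m`;
    -- the factor `x + 1#` is left over in front.
    falling-shift : ∀ x m → falling (x + 1#) (suc m) ≈ (x + 1#) * falling x m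
    falling-shift x zero = trans (*-comm _ _) (*-congʳ (trans (+-congˡ d-zero) (+-identityʳ _)))
    falling-shift x (suc m) = begin
      falling (x + 1#) (suc m) * (x + 1# + d (suc m))
        ≈⟨ *-cong (falling-shift x m) (trans (+-assoc _ _ _) (+-congˡ (d-suc m))) ⟩
      (x + 1#) * falling x m * (x + d m)
        ≈⟨ *-assoc _ _ _ ⟩
      (x + 1#) * (falling x m * (x + d m)) ∎

    binom-pascal : ∀ x m → binom (x + 1#) (suc m) ≈ binom x (suc m) + binom x m
    binom-pascal x m = sym (begin
      e (suc m) * (f * (x + d m)) + e m * f
        ≈⟨ +-congʳ (*-congˡ (*-congˡ (+-congˡ (d-suc m)))) ⟨
      e (suc m) * (f * (x + (1# + d (suc m)))) + e m * f
        -- The semiring solver treats `d (suc m)` and `1#` as atoms. Splitting the last factor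
        -- leaves the coefficient 1/m! - (m+1)/(m+1)!, which `e-suc` cancels.
        ≈⟨ solve 6 (λ e e′ d f x o → e′ :* (f :* (x :+ (o :+ d))) :+ e :* f := e′ :* ((x :+ o) :* f) :+ (e :+ e′ :* d) :* f)
             refl (e m) (e (suc m)) (d (suc m)) f x 1# ⟩
      e (suc m) * ((x + 1#) * f) + (e m + e (suc m) * d (suc m)) * f
        ≈⟨ +-cong (*-congˡ (sym (falling-shift x m))) (trans (*-congʳ (e-suc m)) (zeroˡ f)) ⟩
      e (suc m) * falling (x + 1#) (suc m) + 0#
        ≈⟨ +-identityʳ _ ⟩
      e (suc m) * falling (x + 1#) (suc m) ∎)
      where f = falling x m

-- The commutative ring of coefficient lists

module Polynomials {c ℓ₁ ℓ₂ : Level} (K : HeytingField c ℓ₁ ℓ₂) (char0 : CharacteristicZero K) where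

  scalarRing : CommutativeRing c ℓ₁
  scalarRing = HeytingCommutativeRing.commutativeRing (HeytingField.heytingCommutativeRing K)

  open CommutativeRing scalarRing
  open Eulerian K char0
  open import Algebra.Solver.Ring.NaturalCoefficients.Default commutativeSemiring
  open import Algebra.Properties.Ring ring using (-‿+-comm; -‿distribʳ-*; -0#≈0#)
  open import Algebra.Properties.Semiring.Mult semiring using (×1-homo-*)
  open import Relation.Binary.Reasoning.Setoid setoid

  coeff-+ : ∀ p q k → coeff (p +ₚ q) k ≈ coeff p k + coeff q k
  coeff-+ []      q       k       = sym (+-identityˡ _)
  coeff-+ (x ∷ p) []      k       = sym (+-identityʳ _)
  coeff-+ (x ∷ p) (y ∷ q) zero    = refl
  coeff-+ (x ∷ p) (y ∷ q) (suc k) = coeff-+ p q k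

  coeff-scale : ∀ x p k → coeff (map (x *_) p) k ≈ x * coeff p k
  coeff-scale x []      k       = sym (zeroʳ x)
  coeff-scale x (y ∷ p) zero    = refl
  coeff-scale x (y ∷ p) (suc k) = coeff-scale x p k

  coeff-neg : ∀ p k → coeff (map (λ x → - x) p) k ≈ - coeff p k
  coeff-neg []      k       = sym -0#≈0#
  coeff-neg (x ∷ p) zero    = refl
  coeff-neg (x ∷ p) (suc k) = coeff-neg p k

  coeff-*-zero : ∀ x p q → coeff ((x ∷ p) *ₚ q) 0 ≈ x * coeff q 0
  coeff-*-zero x p q = trans (coeff-+ (map (x *_) q) _ 0) (trans (+-identityʳ _) (coeff-scale x q 0))

  coeff-*-suc : ∀ x p q k → coeff ((x ∷ p) *ₚ q) (suc k) ≈ x * coeff q (suc k) + coeff (p *ₚ q) k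
  coeff-*-suc x p q k = trans (coeff-+ (map (x *_) q) _ (suc k)) (+-congʳ (coeff-scale x q (suc k)))

  +ₚ-cong : ∀ {p p′ q q′} → p ≈ₚ p′ → q ≈ₚ q′ → p +ₚ q ≈ₚ p′ +ₚ q′
  +ₚ-cong {p} {p′} {q} {q′} p≈ q≈ k =
    trans (coeff-+ p q k) (trans (+-cong (p≈ k) (q≈ k)) (sym (coeff-+ p′ q′ k)))

  -- A zero polynomial may be a nonempty list of zeros; `*ₚ-congʳ` meets this case when its two
  -- lists differ in length.
  *ₚ-zeroˡ : ∀ {p} q → p ≈ₚ [] → p *ₚ q ≈ₚ []
  *ₚ-zeroˡ {[]}    q p≈ k = refl
  *ₚ-zeroˡ {x ∷ p} q p≈ zero = trans (coeff-*-zero x p q) (trans (*-congʳ (p≈ 0)) (zeroˡ _))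
  *ₚ-zeroˡ {x ∷ p} q p≈ (suc k) = trans (coeff-*-suc x p q k) (trans
    (+-cong (trans (*-congʳ (p≈ 0)) (zeroˡ _)) (*ₚ-zeroˡ {p} q (λ j → p≈ (suc j)) k)) (+-identityʳ _))

  *ₚ-congˡ : ∀ p {q q′} → q ≈ₚ q′ → p *ₚ q ≈ₚ p *ₚ q′
  *ₚ-congˡ []      q≈ k = refl
  *ₚ-congˡ (x ∷ p) {q} {q′} q≈ zero =
    trans (coeff-*-zero x p q) (trans (*-congˡ (q≈ 0)) (sym (coeff-*-zero x p q′)))
  *ₚ-congˡ (x ∷ p) {q} {q′} q≈ (suc k) = trans (coeff-*-suc x p q k)
    (trans (+-cong (*-congˡ (q≈ (suc k))) (*ₚ-congˡ p q≈ k)) (sym (coeff-*-suc x p q′ k)))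

  *ₚ-congʳ : ∀ {p p′} q → p ≈ₚ p′ → p *ₚ q ≈ₚ p′ *ₚ q
  *ₚ-congʳ {[]}    {p′}     q p≈ k = sym (*ₚ-zeroˡ {p′} q (λ j → sym (p≈ j)) k)
  *ₚ-congʳ {x ∷ p} {[]}     q p≈ k = *ₚ-zeroˡ {x ∷ p} q p≈ k
  *ₚ-congʳ {x ∷ p} {y ∷ p′} q p≈ zero =
    trans (coeff-*-zero x p q) (trans (*-congʳ (p≈ 0)) (sym (coeff-*-zero y p′ q)))
  *ₚ-congʳ {x ∷ p} {y ∷ p′} q p≈ (suc k) = trans (coeff-*-suc x p q k)
    (trans (+-cong (*-congʳ (p≈ 0)) (*ₚ-congʳ {p} {p′} q (λ j → p≈ (suc j)) k)) (sym (coeff-*-suc y p′ q k)))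

  *ₚ-∷-zero : ∀ p y q → coeff (p *ₚ (y ∷ q)) 0 ≈ y * coeff p 0
  *ₚ-∷-zero []      y q = sym (zeroʳ y)
  *ₚ-∷-zero (x ∷ p) y q = trans (coeff-*-zero x p (y ∷ q)) (*-comm x y)

  -- The expansion along the second factor. `_*ₚ_` recurses on the first only, so commutativity
  -- rests on this counterpart of `coeff-*-suc`.
  *ₚ-∷-suc : ∀ p y q k → coeff (p *ₚ (y ∷ q)) (suc k) ≈ y * coeff p (suc k) + coeff (p *ₚ q) k
  *ₚ-∷-suc []      y q k = sym (trans (+-identityʳ _) (zeroʳ y))
  *ₚ-∷-suc (x ∷ p) y q zero = begin
    coeff ((x ∷ p) *ₚ (y ∷ q)) 1                  ≈⟨ coeff-*-suc x p (y ∷ q) 0 ⟩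
    x * coeff q 0 + coeff (p *ₚ (y ∷ q)) 0        ≈⟨ +-cong (sym (coeff-*-zero x p q)) (*ₚ-∷-zero p y q) ⟩
    coeff ((x ∷ p) *ₚ q) 0 + y * coeff p 0        ≈⟨ +-comm _ _ ⟩
    y * coeff p 0 + coeff ((x ∷ p) *ₚ q) 0        ∎
  *ₚ-∷-suc (x ∷ p) y q (suc k) = begin
    coeff ((x ∷ p) *ₚ (y ∷ q)) (suc (suc k))
      ≈⟨ coeff-*-suc x p (y ∷ q) (suc k) ⟩
    x * coeff q (suc k) + coeff (p *ₚ (y ∷ q)) (suc k)
      ≈⟨ +-congˡ (*ₚ-∷-suc p y q k) ⟩
    x * coeff q (suc k) + (y * coeff p (suc k) + coeff (p *ₚ q) k)
      ≈⟨ solve 3 (λ a b c → a :+ (b :+ c) := b :+ (a :+ c)) refl _ _ _ ⟩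
    y * coeff p (suc k) + (x * coeff q (suc k) + coeff (p *ₚ q) k)
      ≈⟨ +-congˡ (coeff-*-suc x p q k) ⟨
    y * coeff p (suc k) + coeff ((x ∷ p) *ₚ q) (suc k) ∎

  *ₚ-comm : ∀ p q → p *ₚ q ≈ₚ q *ₚ p
  *ₚ-comm []      []      k = refl
  *ₚ-comm []      (y ∷ q) zero = sym (trans (coeff-*-zero y q []) (zeroʳ y))
  *ₚ-comm []      (y ∷ q) (suc k) = sym (trans (coeff-*-suc y q [] k)
    (trans (+-cong (zeroʳ y) (sym (*ₚ-comm [] q k))) (+-identityʳ _)))
  *ₚ-comm (x ∷ p) q zero    = trans (coeff-*-zero x p q) (sym (*ₚ-∷-zero q x p))
  *ₚ-comm (x ∷ p) q (suc k) = trans (coeff-*-suc x p q k)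
    (trans (+-congˡ (*ₚ-comm p q k)) (sym (*ₚ-∷-suc q x p k)))

  *ₚ-distribˡ : ∀ p q r → p *ₚ (q +ₚ r) ≈ₚ p *ₚ q +ₚ p *ₚ r
  *ₚ-distribˡ []      q r k = refl
  *ₚ-distribˡ (x ∷ p) q r zero = begin
    coeff ((x ∷ p) *ₚ (q +ₚ r)) 0                         ≈⟨ coeff-*-zero x p (q +ₚ r) ⟩
    x * coeff (q +ₚ r) 0                                  ≈⟨ *-congˡ (coeff-+ q r 0) ⟩
    x * (coeff q 0 + coeff r 0)                           ≈⟨ distribˡ _ _ _ ⟩
    x * coeff q 0 + x * coeff r 0                         ≈⟨ +-cong (coeff-*-zero x p q) (coeff-*-zero x p r) ⟨
    coeff ((x ∷ p) *ₚ q) 0 + coeff ((x ∷ p) *ₚ r) 0       ≈⟨ coeff-+ ((x ∷ p) *ₚ q) _ 0 ⟨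
    coeff ((x ∷ p) *ₚ q +ₚ (x ∷ p) *ₚ r) 0                ∎
  *ₚ-distribˡ (x ∷ p) q r (suc k) = begin
    coeff ((x ∷ p) *ₚ (q +ₚ r)) (suc k)
      ≈⟨ coeff-*-suc x p (q +ₚ r) k ⟩
    x * coeff (q +ₚ r) (suc k) + coeff (p *ₚ (q +ₚ r)) k
      ≈⟨ +-cong (*-congˡ (coeff-+ q r (suc k))) (trans (*ₚ-distribˡ p q r k) (coeff-+ (p *ₚ q) _ k)) ⟩
    x * (coeff q (suc k) + coeff r (suc k)) + (coeff (p *ₚ q) k + coeff (p *ₚ r) k)
      ≈⟨ solve 5 (λ x a b c d → x :* (a :+ b) :+ (c :+ d) := (x :* a :+ c) :+ (x :* b :+ d)) refl _ _ _ _ _ ⟩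
    (x * coeff q (suc k) + coeff (p *ₚ q) k) + (x * coeff r (suc k) + coeff (p *ₚ r) k)
      ≈⟨ +-cong (coeff-*-suc x p q k) (coeff-*-suc x p r k) ⟨
    coeff ((x ∷ p) *ₚ q) (suc k) + coeff ((x ∷ p) *ₚ r) (suc k)
      ≈⟨ coeff-+ ((x ∷ p) *ₚ q) _ (suc k) ⟨
    coeff ((x ∷ p) *ₚ q +ₚ (x ∷ p) *ₚ r) (suc k) ∎

  *ₚ-distribʳ : ∀ r p q → (p +ₚ q) *ₚ r ≈ₚ p *ₚ r +ₚ q *ₚ r
  *ₚ-distribʳ r p q k = trans (*ₚ-comm (p +ₚ q) r k) (trans (*ₚ-distribˡ r p q k)
    (+ₚ-cong {r *ₚ p} {p *ₚ r} {r *ₚ q} {q *ₚ r} (*ₚ-comm r p) (*ₚ-comm r q) k))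

  *ₚ-scale : ∀ x p q k → coeff (map (x *_) p *ₚ q) k ≈ x * coeff (p *ₚ q) k
  *ₚ-scale x []      q k       = sym (zeroʳ x)
  *ₚ-scale x (y ∷ p) q zero    = trans (coeff-*-zero (x * y) (map (x *_) p) q)
    (trans (*-assoc _ _ _) (*-congˡ (sym (coeff-*-zero y p q))))
  *ₚ-scale x (y ∷ p) q (suc k) = begin
    coeff (map (x *_) (y ∷ p) *ₚ q) (suc k)                       ≈⟨ coeff-*-suc (x * y) (map (x *_) p) q k ⟩
    x * y * coeff q (suc k) + coeff (map (x *_) p *ₚ q) k         ≈⟨ +-cong (*-assoc _ _ _) (*ₚ-scale x p q k) ⟩
    x * (y * coeff q (suc k)) + x * coeff (p *ₚ q) k              ≈⟨ distribˡ _ _ _ ⟨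
    x * (y * coeff q (suc k) + coeff (p *ₚ q) k)                  ≈⟨ *-congˡ (coeff-*-suc y p q k) ⟨
    x * coeff ((y ∷ p) *ₚ q) (suc k)                              ∎

  *ₚ-assoc : ∀ p q r → (p *ₚ q) *ₚ r ≈ₚ p *ₚ (q *ₚ r)
  *ₚ-assoc []      q r k = refl
  *ₚ-assoc (x ∷ p) q r k = begin
    coeff ((map (x *_) q +ₚ (0# ∷ p *ₚ q)) *ₚ r) k
      ≈⟨ *ₚ-distribʳ r (map (x *_) q) (0# ∷ p *ₚ q) k ⟩
    coeff (map (x *_) q *ₚ r +ₚ (0# ∷ p *ₚ q) *ₚ r) k
      ≈⟨ coeff-+ (map (x *_) q *ₚ r) _ k ⟩
    coeff (map (x *_) q *ₚ r) k + coeff ((0# ∷ p *ₚ q) *ₚ r) k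
      ≈⟨ +-congʳ (*ₚ-scale x q r k) ⟩
    x * coeff (q *ₚ r) k + coeff ((0# ∷ p *ₚ q) *ₚ r) k
      ≈⟨ last k ⟩
    coeff ((x ∷ p) *ₚ (q *ₚ r)) k ∎
    where
    last : ∀ k → x * coeff (q *ₚ r) k + coeff ((0# ∷ p *ₚ q) *ₚ r) k ≈ coeff ((x ∷ p) *ₚ (q *ₚ r)) k
    last zero    = trans (+-congˡ (trans (coeff-*-zero 0# (p *ₚ q) r) (zeroˡ _)))
      (trans (+-identityʳ _) (sym (coeff-*-zero x p (q *ₚ r))))
    last (suc k) = trans (+-congˡ (trans (coeff-*-suc 0# (p *ₚ q) r k)
      (trans (+-cong (zeroˡ _) (*ₚ-assoc p q r k)) (+-identityˡ _)))) (sym (coeff-*-suc x p (q *ₚ r) k))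

  const-*ₚ : ∀ x p k → coeff (const x *ₚ p) k ≈ x * coeff p k
  const-*ₚ x p zero    = coeff-*-zero x [] p
  const-*ₚ x p (suc k) = trans (coeff-*-suc x [] p k) (+-identityʳ _)

  *ₚ-identityˡ : ∀ p → const 1# *ₚ p ≈ₚ p
  *ₚ-identityˡ p k = trans (const-*ₚ 1# p k) (*-identityˡ _)

  -- The operations repeat those of `polynomials`, so that results of `Sums` apply definitionally to
  -- `Polynomial`.
  polynomialRing : CommutativeRing c ℓ₁
  polynomialRing = record
    { Carrier = K[t]
    ; _≈_     = _≈ₚ_
    ; _+_     = _+ₚ_
    ; _*_     = _*ₚ_
    ; -_      = map (λ x → - x)
    ; 0#      = []
    ; 1#      = const 1#
    ; isCommutativeRing = record
      { isRing = record
        { +-isAbelianGroup = record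
          { isGroup = record
            { isMonoid = record
              { isSemigroup = record
                { isMagma = record
                  { isEquivalence = record
                    { refl  = λ _ → refl
                    ; sym   = λ p≈q k → sym (p≈q k)
                    ; trans = λ p≈q q≈r k → trans (p≈q k) (q≈r k)
                    }
                  ; ∙-cong = λ {p} {p′} {q} {q′} → +ₚ-cong {p} {p′} {q} {q′}
                  }
                ; assoc = λ p q r k → trans (coeff-+ (p +ₚ q) r k) (trans (+-congʳ (coeff-+ p q k))
                    (trans (+-assoc _ _ _) (trans (+-congˡ (sym (coeff-+ q r k))) (sym (coeff-+ p (q +ₚ r) k)))))
                }
              ; identity = (λ _ _ → refl) , (λ p k → trans (coeff-+ p [] k) (+-identityʳ _))
              }
            ; inverse =
                (λ p k → trans (coeff-+ (map (λ x → - x) p) p k) (trans (+-congʳ (coeff-neg p k)) (-‿inverseˡ _))) ,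
                (λ p k → trans (coeff-+ p (map (λ x → - x) p) k) (trans (+-congˡ (coeff-neg p k)) (-‿inverseʳ _)))
            ; ⁻¹-cong = λ {p} {q} p≈q k → trans (coeff-neg p k) (trans (-‿cong (p≈q k)) (sym (coeff-neg q k)))
            }
          ; comm = λ p q k → trans (coeff-+ p q k) (trans (+-comm _ _) (sym (coeff-+ q p k)))
          }
        ; *-cong     = λ {p} {p′} {q} {q′} p≈ q≈ k → trans (*ₚ-congʳ {p} {p′} q p≈ k) (*ₚ-congˡ p′ {q} {q′} q≈ k)
        ; *-assoc    = *ₚ-assoc
        ; *-identity = *ₚ-identityˡ , (λ p k → trans (*ₚ-comm p (const 1#) k) (*ₚ-identityˡ p k))
        ; distrib    = *ₚ-distribˡ , *ₚ-distribʳ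
        }
      ; *-comm = *ₚ-comm
      }
    }

  module P = CommutativeRing polynomialRing

  -- Constants, monomials and binomials in t

  const-cong : ∀ {x y} → x ≈ y → const x ≈ₚ const y
  const-cong x≈y zero    = x≈y
  const-cong x≈y (suc _) = refl

  const-0 : const 0# ≈ₚ []
  const-0 zero    = refl
  const-0 (suc _) = refl

  const-* : ∀ x y → const (x * y) ≈ₚ const x *ₚ const y
  const-* x y k = sym (trans (const-*ₚ x (const y) k) (at k))
    where
    at : ∀ k → x * coeff (const y) k ≈ coeff (const (x * y)) k
    at zero    = refl
    at (suc _) = zeroʳ x

  coeff-t-zero : ∀ p → coeff (t *ₚ p) 0 ≈ 0#
  coeff-t-zero p = trans (coeff-*-zero 0# (const 1#) p) (zeroˡ _)

  coeff-t-suc : ∀ p k → coeff (t *ₚ p) (suc k) ≈ coeff p k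
  coeff-t-suc p k = trans (coeff-*-suc 0# (const 1#) p k) (trans (+-cong (zeroˡ _) (*ₚ-identityˡ p k)) (+-identityˡ _))

  coeff-monomial : ∀ k x → coeff ((t ^ k) *ₚ const x) k ≈ x
  coeff-monomial zero    x = *ₚ-identityˡ (const x) 0
  coeff-monomial (suc k) x = trans (*ₚ-assoc t (t ^ k) (const x) (suc k))
    (trans (coeff-t-suc ((t ^ k) *ₚ const x) k) (coeff-monomial k x))

  coeff-monomial-≢ : ∀ j k x → j ≢ k → coeff ((t ^ j) *ₚ const x) k ≈ 0#
  coeff-monomial-≢ zero    zero    x j≢k = contradiction ≡.refl j≢k
  coeff-monomial-≢ zero    (suc k) x j≢k = *ₚ-identityˡ (const x) (suc k)
  coeff-monomial-≢ (suc j) zero    x j≢k = trans (*ₚ-assoc t (t ^ j) (const x) 0) (coeff-t-zero ((t ^ j) *ₚ const x))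
  coeff-monomial-≢ (suc j) (suc k) x j≢k = trans (*ₚ-assoc t (t ^ j) (const x) (suc k))
    (trans (coeff-t-suc ((t ^ j) *ₚ const x) k) (coeff-monomial-≢ j k x λ j≡k → j≢k (≡.cong suc j≡k)))

  -- The first factor of a nonempty falling factorial is `t − 0`, whose constant term vanishes.
  coeff-binomial-zero : ∀ m → coeff (binomial t (suc m)) 0 ≈ 0#
  coeff-binomial-zero m = trans (const-*ₚ (1/ suc m !) (fallingFactorial t (suc m)) 0)
    (trans (*-congˡ (vanishes m)) (zeroʳ _))
    where
    vanishes : ∀ m → coeff (fallingFactorial t (suc m)) 0 ≈ 0#
    vanishes zero    = trans (*ₚ-identityˡ (t +ₚ const (- 0#)) 0) (trans (+-identityˡ _) -0#≈0#)
    vanishes (suc m) = trans (*ₚ-comm (fallingFactorial t (suc m)) _ 0)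
      (trans (coeff-*-zero _ (1# ∷ []) (fallingFactorial t (suc m)))
        (trans (*-congˡ (vanishes m)) (zeroʳ _)))

  coeff-binomial-> : ∀ m {k} → m ℕ.< k → coeff (binomial t m) k ≈ 0#
  coeff-binomial-> m {k} m<k = trans (const-*ₚ (1/ m !) (fallingFactorial t m) k)
    (trans (*-congˡ (vanishes m m<k)) (zeroʳ _))
    where
    vanishes : ∀ m {k} → m ℕ.< k → coeff (fallingFactorial t m) k ≈ 0#
    vanishes zero    {suc k} _         = refl
    vanishes (suc m) {suc k} (s≤s m<k) = begin
      coeff (fallingFactorial t (suc m)) (suc k)
        ≈⟨ *ₚ-comm (fallingFactorial t m) _ (suc k) ⟩
      coeff ((t +ₚ const (- fromℕ K m)) *ₚ fallingFactorial t m) (suc k)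
        ≈⟨ coeff-*-suc _ (1# ∷ []) (fallingFactorial t m) k ⟩
      (0# + - fromℕ K m) * coeff (fallingFactorial t m) (suc k) + coeff (const 1# *ₚ fallingFactorial t m) k
        ≈⟨ +-cong (*-congˡ (vanishes m (ℕ.m≤n⇒m≤1+n m<k)))
                  (trans (*ₚ-identityˡ (fallingFactorial t m) k) (vanishes m m<k)) ⟩
      (0# + - fromℕ K m) * 0# + 0#
        ≈⟨ trans (+-identityʳ _) (zeroʳ _) ⟩
      0# ∎

  1/!-inverse : ∀ m → 1/ m ! * fromℕ K (m !) ≈ 1#
  -- The inverse from `#⇒invertible` belongs to `fromℕ K (m !) - 0#`, so the `0#` is removed first.
  1/!-inverse m = trans (*-congˡ (sym (trans (+-congˡ -0#≈0#) (+-identityʳ _))))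
    (proj₁ (proj₂ (HeytingField.#⇒invertible K (char0 (m !) ⦃ ℕ._!≢0 m ⦄))))

  1/!-suc : ∀ m → 1/ suc m ! * fromℕ K (suc m) ≈ 1/ m !
  1/!-suc m = begin
    a * x                 ≈⟨ *-identityʳ _ ⟨
    a * x * 1#            ≈⟨ *-congˡ (1/!-inverse m) ⟨
    a * x * (b * y)       ≈⟨ solve 4 (λ a x b y → a :* x :* (b :* y) := a :* (x :* y) :* b) refl a x b y ⟩
    a * (x * y) * b       ≈⟨ *-congʳ (*-congˡ (×1-homo-* (suc m) (m !))) ⟨
    a * fromℕ K (suc m !) * b ≈⟨ *-congʳ (1/!-inverse (suc m)) ⟩
    1# * b                ≈⟨ *-identityˡ _ ⟩
    b                     ∎
    where
    a = 1/ suc m !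
    b = 1/ m !
    x = fromℕ K (suc m)
    y = fromℕ K (m !)

  1-fromℕ-suc : ∀ m → 1# + - (1# + fromℕ K m) ≈ - fromℕ K m
  1-fromℕ-suc m = begin
    1# + - (1# + fromℕ K m)        ≈⟨ +-congˡ (-‿+-comm 1# (fromℕ K m)) ⟨
    1# + (- 1# + - fromℕ K m)      ≈⟨ +-assoc _ _ _ ⟨
    1# + - 1# + - fromℕ K m        ≈⟨ +-congʳ (-‿inverseʳ 1#) ⟩
    0# + - fromℕ K m               ≈⟨ +-identityˡ _ ⟩
    - fromℕ K m                    ∎

  1/!-cancel : ∀ m → 1/ m ! + 1/ suc m ! * - fromℕ K (suc m) ≈ 0#
  1/!-cancel m = trans (+-cong (sym (1/!-suc m)) (sym (-‿distribʳ-* _ _))) (-‿inverseʳ _)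

  module Binomials = BinomialCoefficients.Factors polynomialRing
    (λ m → const (- fromℕ K m)) (λ m → const (1/ m !))
    (λ k → trans (const-cong -0#≈0# k) (const-0 k))
    (λ m → const-cong (1-fromℕ-suc m))
    (λ m k → trans (coeff-+ (const (1/ m !)) (const (1/ suc m !) *ₚ const (- fromℕ K (suc m))) k) (trans
      (+-congˡ (sym (const-* (1/ suc m !) (- fromℕ K (suc m)) k)))
      (trans (sym (coeff-+ (const (1/ m !)) (const (1/ suc m ! * - fromℕ K (suc m))) k))
        (trans (const-cong (1/!-cancel m) k) (const-0 k)))))

  -- The two falling factorials are separate copies of one recursion and agree only after induction
  -- on `m`.
  binomial≡ : ∀ p m → binomial p m ≡ Binomials.binom p m
  binomial≡ p m = ≡.cong (const (1/ m !) *ₚ_) (ff≡ m)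
    where
    ff≡ : ∀ m → fallingFactorial p m ≡ Binomials.falling p m
    ff≡ zero    = ≡.refl
    ff≡ (suc m) = ≡.cong (_*ₚ (p +ₚ const (- fromℕ K m))) (ff≡ m)

  binomial-cong : ∀ {p q} m → p ≈ₚ q → binomial p m ≈ₚ binomial q m
  binomial-cong {p} {q} m p≈q = ≡.subst₂ _≈ₚ_ (≡.sym (binomial≡ p m)) (≡.sym (binomial≡ q m))
    (Binomials.binom-cong {p} {q} m p≈q)

  t+ : ℕ → K[t]
  t+ m = t +ₚ const (fromℕ K m)

  binomial-pascal : ∀ m r → binomial (t+ (suc m)) (suc r) ≈ₚ binomial (t+ m) (suc r) +ₚ binomial (t+ m) r
  binomial-pascal m r k = trans (binomial-cong {t+ (suc m)} {t+ m +ₚ const 1#} (suc r) shift k)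
    (≡.subst₂ _≈ₚ_ (≡.sym (binomial≡ (t+ m +ₚ const 1#) (suc r)))
      (≡.sym (≡.cong₂ _+ₚ_ (binomial≡ (t+ m) (suc r)) (binomial≡ (t+ m) r)))
      (Binomials.binom-pascal (t+ m) r) k)
    where
    shift : t+ (suc m) ≈ₚ t+ m +ₚ const 1#
    shift zero          = trans (+-congˡ (+-comm 1# _)) (sym (+-assoc _ _ _))
    shift (suc zero)    = refl
    shift (suc (suc k)) = refl

-- The coefficients of U v

module _ {c ℓ₁ ℓ₂ : Level} (K : HeytingField c ℓ₁ ℓ₂) (char0 : CharacteristicZero K) where

  open Polynomials K char0
  open CommutativeRing scalarRing hiding (zero)
  open Eulerian K char0
  open Polynomial
  open import Relation.Binary.Reasoning.Setoid setoid

  private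
    module SK = Sums scalarRing
    module SP = Sums polynomialRing
    variable n : ℕ

  coeff-sum : ∀ {i} {I : Set i} (xs : List I) (f : I → K[t]) k → coeff (SP.sum xs f) k ≈ SK.sum xs (λ x → coeff (f x) k)
  coeff-sum []       f k = refl
  coeff-sum (x ∷ xs) f k = trans (coeff-+ (f x) _ k) (+-congˡ (coeff-sum xs f k))

  coeff-⟦⟧ : ∀ {p} {P : Set p} (P? : Dec P) x k → coeff (SP.⟦ P? ⟧ x) k ≡ SK.⟦ P? ⟧ coeff x k
  coeff-⟦⟧ P? x k with does P?
  ... | true  = ≡.refl
  ... | false = ≡.refl

  σ₁ᵗ-coefficient : (u : PackedWord n) → σ₁ᵗ n u ≈ₚ binomial t (max (word u))
  σ₁ᵗ-coefficient {n} u = SP.∑-N {xs = packedWords n} {λ x → binomial t (max (word x))}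
    (packedWords-unique n) (∈-packedWords u)

  -- Multiplying by `N v` merely selects summands, which commutes with taking a coefficient.
  coeff-U : (v w : PackedWord n) → ∀ k → coeff (U v w) k ≈ (E n k Scalar.∗ Scalar.N v) w
  coeff-U {n} v w k = begin
    coeff (U v w) k
      ≈⟨ SP.∗-N (σ₁ᵗ n) v w k ⟩
    coeff (SP.sum (packedWords n) (λ u → SP.⟦ packBiword u v ≟ᵖ w ⟧ σ₁ᵗ n u)) k
      ≈⟨ coeff-sum (packedWords n) _ k ⟩
    SK.sum (packedWords n) (λ u → coeff (SP.⟦ packBiword u v ≟ᵖ w ⟧ σ₁ᵗ n u) k)
      ≈⟨ SK.sum-cong (packedWords n) (λ u → reflexive (coeff-⟦⟧ (packBiword u v ≟ᵖ w) (σ₁ᵗ n u) k)) ⟩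
    SK.sum (packedWords n) (λ u → SK.⟦ packBiword u v ≟ᵖ w ⟧ E n k u)
      ≈⟨ SK.∗-N (E n k) v w ⟨
    (E n k Scalar.∗ Scalar.N v) w ∎

  -- The expansion in the Eulerian idempotents

  E∗N-zero : ∀ k → (∀ u → E n k u ≈ 0#) → (v w : PackedWord n) → (E n k Scalar.∗ Scalar.N v) w ≈ 0#
  E∗N-zero {n} k E≈0 v w = trans (SK.∗-N (E n k) v w)
    (SK.sum-zero (packedWords n) λ {u} _ → trans (SK.⟦⟧-cong (packBiword u v ≟ᵖ w) (E≈0 u)) (zero-term u))
    where
    zero-term : ∀ u → SK.⟦ packBiword u v ≟ᵖ w ⟧ 0# ≈ 0#
    zero-term u with does (packBiword u v ≟ᵖ w)
    ... | true  = refl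
    ... | false = refl

  E-zero : 1 ≤ n → (u : PackedWord n) → E n 0 u ≈ 0#
  E-zero {suc n} _ u = trans (σ₁ᵗ-coefficient u 0) (vanishes (max (word u))
    (ℕ.≤-trans (Packed.positive (word-packed u) Fin.zero) (Packed.bounded (word-packed u) Fin.zero)))
    where
    vanishes : ∀ m → 1 ≤ m → coeff (binomial t m) 0 ≈ 0#
    vanishes (suc m) _ = coeff-binomial-zero m

  E-> : ∀ {k} → n ℕ.< k → (u : PackedWord n) → E n k u ≈ 0#
  E-> {k = k} n<k u = trans (σ₁ᵗ-coefficient u k) (coeff-binomial-> (max (word u))
    (ℕ.≤-<-trans (Packed⇒≤length (word-packed u)) n<k))

  U-expansion : (v : PackedWord n) → 1 ≤ n →
    U v ≋ (∑[ k ← map suc (upTo n) ] (t ^ k) · extend (E n k Scalar.∗ Scalar.N v))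
  U-expansion {n} v 1≤n w j = trans (coeff-U v w j) (sym (begin
    coeff ((∑[ k ← ks ] (t ^ k) · extend (E n k Scalar.∗ Scalar.N v)) w) j
      ≡⟨ ≡.cong (λ p → coeff p j) (SP.∑-apply ks _ w) ⟩
    coeff (SP.sum ks (λ k → (t ^ k) *ₚ const (e k))) j
      ≈⟨ coeff-sum ks _ j ⟩
    SK.sum ks (λ k → coeff ((t ^ k) *ₚ const (e k)) j)
      ≈⟨ select j ⟩
    e j ∎))
    where
    ks = map suc (upTo n)

    e : ℕ → Carrier
    e k = (E n k Scalar.∗ Scalar.N v) w

    absent : ∀ j → e j ≈ 0# → ¬ (j List.∈ ks) → SK.sum ks (λ k → coeff ((t ^ k) *ₚ const (e k)) j) ≈ e j
    absent j ej≈0 j∉ = trans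
      (SK.sum-zero ks λ {k} k∈ → coeff-monomial-≢ k j (e k) λ { ≡.refl → j∉ k∈ }) (sym ej≈0)

    select : ∀ j → SK.sum ks (λ k → coeff ((t ^ k) *ₚ const (e k)) j) ≈ e j
    -- Degree 0 is missing from the list of summands; `1 ≤ n` makes its coefficient vanish.
    select zero    = absent zero (E∗N-zero 0 (E-zero 1≤n) v w) λ 0∈ → case0 (List.∈-map⁻ suc 0∈)
      where
      case0 : ¬ ∃ λ k → k List.∈ upTo n × 0 ≡ suc k
      case0 (_ , _ , ())
    select (suc j) with j ℕ.<? n
    ... | yes j<n = trans (SK.sum-single (Unique.map⁺ ℕ.suc-injective (Unique.upTo⁺ n))
            (List.∈-map⁺ suc (List.∈-upTo⁺ j<n)) (λ {k} k≢ → coeff-monomial-≢ k (suc j) (e k) k≢))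
            (coeff-monomial (suc j) (e (suc j)))
    ... | no j≮n  = absent (suc j) (E∗N-zero (suc j) (E-> (s≤s (ℕ.≮⇒≥ j≮n))) v w) λ j∈ → absurd (List.∈-map⁻ suc j∈)
      where
      absurd : ¬ ∃ λ k → k List.∈ upTo n × suc j ≡ suc k
      absurd (_ , k∈ , ≡.refl) = j≮n (List.∈-upTo⁻ k∈)

  -- Turns the count into the difference of the statement, which is taken in the field and not
  -- truncated.
  t+-excess : ∀ {a m r} → a ℕ.+ m ≡ r → t+ m ≈ₚ t +ₚ const (fromℕ K r - fromℕ K a)
  t+-excess {a} {m} ≡.refl =
    +ₚ-cong {t} {t} {const (fromℕ K m)} {const (fromℕ K (a ℕ.+ m) - fromℕ K a)} (λ _ → refl) (const-cong (begin
    fromℕ K m                                   ≈⟨ +-identityʳ _ ⟨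
    fromℕ K m + 0#                              ≈⟨ +-congˡ (-‿inverseʳ _) ⟨
    fromℕ K m + (fromℕ K a - fromℕ K a)         ≈⟨ +-assoc _ _ _ ⟨
    fromℕ K m + fromℕ K a - fromℕ K a           ≈⟨ +-congʳ (+-comm _ _) ⟩
    fromℕ K a + fromℕ K m - fromℕ K a           ≈⟨ +-congʳ (×-homo-+ 1# a m) ⟨
    fromℕ K (a ℕ.+ m) - fromℕ K a               ∎))
    where open import Algebra.Properties.Semiring.Mult semiring using (×-homo-+)

  -- The expansion over weak refinements

  refinementCoefficient : PackedWord n → PackedWord n → K[t]
  refinementCoefficient v w = binomial (t +ₚ const (fromℕ K (max (word w)) - fromℕ K (a₀ v w))) (max (word w))

  -- At cut-off `max w ∸ 1` the coarsenings of `w` are exactly the `u` with pack(u,v) = `w`, so the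
  -- coarsening sum is the whole coefficient.
  U-∈WRef : (v w : PackedWord n) → w ∈WRef v → U v w ≈ₚ refinementCoefficient v w
  U-∈WRef {n} v w w∈ j = trans (SP.∗-N (σ₁ᵗ n) v w j) (trans
    (SP.sum-cong (packedWords n) {λ u → SP.⟦ packBiword u v ≟ᵖ w ⟧ σ₁ᵗ n u}
      {λ u → SP.⟦ coarsening? (word v) r′ (word w) (word u) ⟧ binomial (t+ 0) (max (word u))} summand j) (trans
    (SP.coarseningSum≈ (λ m → binomial (t+ m)) binomial-pascal (word v) r′ (word-packed w) ℕ.≤-refl j)
    (binomial-cong (max (word w)) (t+-excess {a₀ v w} {mergeableCount (word v) (word w) r′} (a₀+mergeableCount v w)) j)))
    where
    r′ = max (word w) ∸ 1

    t+0 : t ≈ₚ t+ 0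
    t+0 zero          = sym (+-identityʳ _)
    t+0 (suc zero)    = refl
    t+0 (suc (suc _)) = refl

    summand : ∀ u → SP.⟦ packBiword u v ≟ᵖ w ⟧ σ₁ᵗ n u ≈ₚ
      SP.⟦ coarsening? (word v) r′ (word w) (word u) ⟧ binomial (t+ 0) (max (word u))
    summand u k = trans
      (SP.⟦⟧-⇔ (packBiword u v ≟ᵖ w) (coarsening? (word v) r′ (word w) (word u)) (packBiword≡⇔Coarsening u v w w∈) k)
      (SP.⟦⟧-cong (coarsening? (word v) r′ (word w) (word u)) {σ₁ᵗ n u} {binomial (t+ 0) (max (word u))}
        (λ l → trans (σ₁ᵗ-coefficient u l) (binomial-cong {t} {t+ 0} (max (word u)) t+0 l)) k)

  U-∉WRef : (v w : PackedWord n) → ¬ w ∈WRef v → U v w ≈ₚ []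
  U-∉WRef {n} v w w∉ j = trans (SP.∗-N (σ₁ᵗ n) v w j)
    (SP.sum-zero (packedWords n) (λ {u} _ → SP.⟦⟧-false (packBiword u v ≟ᵖ w) (w∉ ∘ packBiword≡⇒∈WRef u v w)) j)

  U-refinements : (v : PackedWord n) → U v ≋ (∑[ w ← WRef v ] refinementCoefficient v w · N w)
  U-refinements {n} v w j = go (w ∈WRef? v)
    where
    go : Dec (w ∈WRef v) → coeff (U v w) j ≈ coeff ((∑[ w ← WRef v ] refinementCoefficient v w · N w) w) j
    go (yes w∈) = trans (U-∈WRef v w w∈ j) (sym (SP.∑-N {xs = WRef v} {refinementCoefficient v}
      (Unique.filter⁺ (_∈WRef? v) (packedWords-unique n)) (List.∈-filter⁺ (_∈WRef? v) (∈-packedWords w) w∈) j))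
    go (no w∉)  = trans (U-∉WRef v w w∉ j) (sym (SP.∑-N-∉ {xs = WRef v} {refinementCoefficient v}
      (w∉ ∘ proj₂ ∘ List.∈-filter⁻ (_∈WRef? v) {xs = packedWords n}) j))

mainTheorem3 :
    ∀ {c ℓ₁ ℓ₂} (K : HeytingField c ℓ₁ ℓ₂) (char0 : CharacteristicZero K) →
    let open HeytingField K using (_-_)
        open Eulerian K char0
        open Polynomial
    in ∀ {n} (v : PackedWord n) →
       (1 ≤ n →
        U v ≋ (∑[ k ← map suc (upTo n) ] (t ^ k) · extend (E n k Scalar.∗ Scalar.N v)))
       ×
       (U v ≋ (∑[ w ← WRef v ]
         binomial (t +ₚ const (fromℕ K (max (word w)) - fromℕ K (a₀ v w))) (max (word w)) · N w))
mainTheorem3 K char0 v = U-expansion K char0 v , U-refinements K char0 v
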